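{- Let $G$ and $H$ be finite simple undirected graphs with $k=\chi(G^2)$ and $\ell=\chi(H^2)$. Then $$\chi_o^+(G\times H)\le\frac{2^{k(\ell-1)}-1}{2^{\ell-1}-1}.$$
   Context: An oriented graph is a digraph with no loops, no multiple arcs and no pair of opposite arcs; an orientation of an undirected graph gives each edge one of its two directions. A homomorphism between oriented graphs is a vertex map sending arcs to arcs. The upper oriented chromatic number $\chi_o^+(G)$ is the smallest order of an oriented graph $\vec T$ such that every orientation of $G$ admits a homomorphism to $\vec T$. The square $G^2$ has vertex set $V(G)$, with $u,v$ adjacent iff their distance in $G$ is 1 or 2; $\chi$ is the chromatic number. The direct product $G\times H$ has vertex set $V(G)\times V(H)$, and $\{[u,v],[u',v']\}$ is an edge iff $\{u,u'\}\in E(G)$ and $\{v,v'\}\in E(H)$.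
   Formalization: The formal statement assumes ℓ ≥ 2 (H has an edge), since for ℓ = 1 the denominator 2^{ℓ-1}-1 is 0 and the bound reads 0/0; the case of H without vertices (ℓ = 0) is thereby also left out. -}

module Defs where

import Data.Nat
open import Data.Nat using (ℕ; _≤_)
open import Data.Fin using (Fin)
open import Data.Bool using (Bool; true; false; T; _∧_)
open import Data.Product using (Σ; ∃; _×_; _,_)
open import Data.Sum using (_⊎_)
open import Relation.Nullary using (¬_)
open import Relation.Binary.PropositionalEquality using (_≡_)

record Graph : Set where
  field
    n     : ℕ
    adj   : Fin n → Fin n → Bool
    sym   : ∀ u v → adj u v ≡ adj v u
    irref : ∀ u → adj u u ≡ false

open Graph public

Colouring : (V : Set) → (V → V → Set) → ℕ → Set
Colouring V E c = Σ (V → Fin c) λ f → ∀ u v → E u v → ¬ (f u ≡ f v)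

IsChromaticNumber : (V : Set) → (V → V → Set) → ℕ → Set
IsChromaticNumber V E c = Colouring V E c × (∀ d → Colouring V E d → c ≤ d)

SqAdj : (G : Graph) → Fin (n G) → Fin (n G) → Set
SqAdj G u v = ¬ (u ≡ v) × (T (adj G u v) ⊎ ∃ λ w → T (adj G u w) × T (adj G w v))

ChiSquare : Graph → ℕ → Set
ChiSquare G c = IsChromaticNumber (Fin (n G)) (SqAdj G) c

ProdV : Graph → Graph → Set
ProdV G H = Fin (n G) × Fin (n H)

ProdAdj : (G H : Graph) → ProdV G H → ProdV G H → Set
ProdAdj G H (u , v) (u' , v') = T (adj G u u' ∧ adj H v v')

record OrientedGraph (m : ℕ) : Set₁ where
  field
    Arc      : Fin m → Fin m → Set
    noLoop   : ∀ u → ¬ Arc u u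
    noOpp    : ∀ u v → Arc u v → ¬ Arc v u

record Orientation (V : Set) (E : V → V → Set) : Set₁ where
  field
    Arc     : V → V → Set
    arcEdge : ∀ u v → Arc u v → E u v
    edgeArc : ∀ u v → E u v → Arc u v ⊎ Arc v u
    noOpp   : ∀ u v → Arc u v → ¬ Arc v u

Hom : {V : Set} {E : V → V → Set} → Orientation V E → {m : ℕ} → OrientedGraph m → Set
Hom {V} O {m} T' = Σ (V → Fin m) λ f → ∀ u v → Orientation.Arc O u v → OrientedGraph.Arc T' (f u) (f v)

UpperOrientedChiAtMost : (V : Set) → (V → V → Set) → ℕ → Set₁
UpperOrientedChiAtMost V E N =
  Σ ℕ λ m → m ≤ N × Σ (OrientedGraph m) λ T' → (O : Orientation V E) → Hom O T'

-- Natural-number quotient a / d (only used with d ≠ 0; the value for d = 0 is irrelevant).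
_div_ : ℕ → ℕ → ℕ
a div ℕ.zero = 0
a div ℕ.suc d = a Data.Nat./ ℕ.suc d

{-# OPTIONS --safe #-}

-- Colour the squares of G and H with k and ℓ colours. A vertex of G × H then has at most one
-- neighbour in each pair of colour classes, so after adding dummy vertices the product becomes a
-- cover of K_k × K_ℓ, and it suffices to find an oriented graph to which every oriented cover of
-- K_k × K_ℓ maps.
--
-- Write q = 2^(ℓ-1) and B_k = 1 + q + … + q^(k-1). A target of order m for k becomes one of order
-- ℓ + q m for k + 1: the ℓ new classes become single vertices, and an old vertex stores its ℓ - 1
-- arcs to them as a vector of even weight in F₂^ℓ, its own coordinate being free to correct the
-- parity. As ℓ ≤ q, m < B_k is inherited by k + 1.
--
-- For k = 2 the cover of K_2 × K_ℓ is a cover of K_ℓ, and q vertices are wanted. For ℓ = 3, 4 this is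
-- a statement about the cycles spanned by three classes, whose closing up is settled by a finite
-- family of relations; for ℓ = 7 it suffices that every vertex stores its arcs to half of the other
-- classes, and each further class costs m ↦ 2 m + 1. This leaves ℓ = 5, 6, where only q + 1
-- vertices are reached, and where the induction starts from k = 3 instead.
module Submission where

open import Defs hiding (n; adj; sym; irref)
open import Axiom.UniquenessOfIdentityProofs.WithK using (uip)
open import Data.Bool using (Bool; true; false; not; _∧_; _∨_; _xor_; T; T?)
open import Data.Bool.Properties using (not-involutive; xor-same; T-∧)
open import Data.Empty using (⊥; ⊥-elim)
open import Data.Fin using (Fin; zero; suc; toℕ; punchIn; punchOut)
open import Data.Fin.Properties using (_≟_; any?; all?; 0↔⊥; 1↔⊤; 2↔Bool; +↔⊎; *↔×; punchIn-punchOut)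
open import Data.List using (List; []; _∷_)
open import Data.List.Membership.Propositional using (_∈_)
open import Data.List.Relation.Unary.Any using (here; there)
open import Data.Maybe using (Maybe; just; nothing)
import Data.Maybe.Properties as Maybe
open import Data.Nat using (ℕ; zero; suc; _+_; _*_; _∸_; _^_; _≤_; _<_; _%_; z≤n; s≤s)
open import Data.Nat.DivMod using (m*n/n≡m)
open import Data.Nat.Properties using (≤-refl; ≤-trans; ≤-reflexive; <⇒≤; +-comm; +-identityʳ; +-monoˡ-≤; *-comm; *-assoc; *-suc; *-distribʳ-+; *-identityʳ; *-monoʳ-≤; ^-*-assoc; _≤?_; module ≤-Reasoning)
open import Data.Product using (Σ; ∃; _×_; _,_; proj₁; proj₂)
open import Data.Product.Function.NonDependent.Propositional using (_×-↔_)
open import Data.Product.Properties using (≡-dec)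
open import Data.Sum using (_⊎_; inj₁; inj₂)
open import Data.Sum.Function.Propositional using (_⊎-↔_)
open import Data.Unit using (⊤; tt)
open import Data.Vec using (Vec; []; _∷_; lookup; map; replicate; zipWith; tabulate)
open import Data.Vec.Properties using (lookup-map; lookup-zipWith; lookup-replicate; lookup∘tabulate)
open import Function using (_↔_; Inverse; Equivalence)
open import Function.Construct.Composition using (_↔-∘_)
open import Function.Construct.Identity using (↔-id)
open import Relation.Binary.PropositionalEquality
open import Relation.Nullary using (Dec; yes; no; ¬_; does)
open import Relation.Nullary.Decidable using (from-yes; map′; _×-dec_; _⊎-dec_)

-- Boolean checks

∧-split : ∀ {a b} → a ∧ b ≡ true → a ≡ true × b ≡ true
∧-split {true} h = refl , h

∨-split : ∀ {a b} → a ∨ b ≡ true → a ≡ true ⊎ b ≡ true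
∨-split {true}  h = inj₁ refl
∨-split {false} h = inj₂ h

every : ∀ {n} → (Fin n → Bool) → Bool
every {zero}  f = true
every {suc n} f = f zero ∧ every (λ i → f (suc i))

every-at : ∀ {n} (f : Fin n → Bool) → every f ≡ true → ∀ i → f i ≡ true
every-at f h zero    = proj₁ (∧-split h)
every-at f h (suc i) = every-at (λ j → f (suc j)) (proj₂ (∧-split {f zero} h)) i

both : (Bool → Bool) → Bool
both f = f true ∧ f false

both-at : (f : Bool → Bool) → both f ≡ true → ∀ b → f b ≡ true
both-at f h true  = proj₁ (∧-split h)
both-at f h false = proj₂ (∧-split {f true} h)

everyIn : {A : Set} → (A → Bool) → List A → Bool
everyIn f []       = true
everyIn f (x ∷ xs) = f x ∧ everyIn f xs

everyIn-at : {A : Set} (f : A → Bool) {xs : List A} → everyIn f xs ≡ true → ∀ {x} → x ∈ xs → f x ≡ true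
everyIn-at f {x ∷ xs} h (here refl) = proj₁ (∧-split h)
everyIn-at f {x ∷ xs} h (there x∈)  = everyIn-at f (proj₂ (∧-split {f x} h)) x∈

someIn : {A : Set} → (A → Bool) → List A → Bool
someIn f []       = false
someIn f (x ∷ xs) = f x ∨ someIn f xs

someIn-find : {A : Set} (f : A → Bool) (xs : List A) → someIn f xs ≡ true → ∃ λ x → x ∈ xs × f x ≡ true
someIn-find f (x ∷ xs) h with ∨-split h
... | inj₁ fx = x , here refl , fx
... | inj₂ h′ with someIn-find f xs h′
...   | y , y∈ , fy = y , there y∈ , fy

_⇔ᵇ_ : Bool → Bool → Bool
true  ⇔ᵇ b = b
false ⇔ᵇ b = not b

⇔ᵇ-≡ : ∀ {a b} → (a ⇔ᵇ b) ≡ true → a ≡ b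
⇔ᵇ-≡ {true}  {true}  _ = refl
⇔ᵇ-≡ {false} {false} _ = refl

not-both : ∀ b → b ≡ true → ¬ not b ≡ true
not-both true _ ()

antisymmetric : ∀ {n} → (Fin n → Fin n → Bool) → Bool
antisymmetric arc = every λ i → every λ j → not (arc i j ∧ arc j i)

antisymmetric-at : ∀ {n} (arc : Fin n → Fin n → Bool) → antisymmetric arc ≡ true →
                   ∀ i j → arc i j ≡ true → ¬ arc j i ≡ true
antisymmetric-at arc h i j ij ji = not-both _ (cong₂ _∧_ ij ji)
  (every-at (λ j → not (arc i j ∧ arc j i)) (every-at (λ i → every λ j → not (arc i j ∧ arc j i)) h i) j)

-- Covers and universal targets

-- A cover has a copy of V over every class; (i , u) has the single neighbour (j , mate i j u) in
-- every class j adjacent to i, and out i j u tells whether the arc between them leaves (i , u).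
record Cover (C : Set) (Adj : C → C → Set) (V : Set) : Set where
  field
    mate      : C → C → V → V
    mate-mate : ∀ {i j} → Adj i j → ∀ u → mate j i (mate i j u) ≡ u
    out       : C → C → V → Bool
    out-mate  : ∀ {i j} → Adj i j → ∀ u → out j i (mate i j u) ≡ not (out i j u)

along : {X : Set} → (X → X → Bool) → Bool → X → X → Bool
along arc true  x y = arc x y
along arc false x y = arc y x

along-not : ∀ {X : Set} (arc : X → X → Bool) s {x y} → along arc (not s) y x ≡ along arc s x y
along-not arc true  = refl
along-not arc false = refl

module _ {C : Set} {Adj : C → C → Set} {V X : Set} (S : Cover C Adj V) (arc : X → X → Bool) (x : C → V → X) where
  open Cover S

  Respects : C → C → Set
  Respects i j = ∀ u → along arc (out i j u) (x i u) (x j (mate i j u)) ≡ true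

  -- Every vertex of class `j` is the mate of one of class `i`, and seen from there the sign is
  -- negated. Hence each pair of classes needs checking in one direction only.
  respects-sym : ∀ {i j} → Adj i j → Adj j i → Respects i j → Respects j i
  respects-sym {i} {j} ij ji r u = begin
    along arc (out j i u) (x j u) (x i v)                   ≡⟨ along-not arc (out j i u) ⟨
    along arc (not (out j i u)) (x i v) (x j u)             ≡⟨ cong₂ (λ s w → along arc s (x i v) (x j w)) (out-mate ji u) (mate-mate ji u) ⟨
    along arc (out i j v) (x i v) (x j (mate i j v))        ≡⟨ r v ⟩
    true                                                    ∎
    where
    open ≡-Reasoning
    v = mate j i u

Coloured : {C : Set} {Adj : C → C → Set} {V X : Set} → Cover C Adj V → (X → X → Bool) → Set
Coloured {C} {Adj} {V} {X} S arc = Σ (C → V → X) λ x → ∀ {i j} → Adj i j → Respects S arc x i j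

-- The target is fixed before the cover and before `V`. Finiteness of `V` lets permutations of it be
-- solved by removing vertices one at a time. Taken at equal arguments, `asym` excludes loops;
-- Boolean arcs let it be checked by evaluation.
record Universal (C : Set) (Adj : C → C → Set) (m : ℕ) : Set₁ where
  field
    X      : Set
    size   : Fin m ↔ X
    arc    : X → X → Bool
    asym   : ∀ x y → arc x y ≡ true → ¬ arc y x ≡ true
    colour : ∀ {V N} → Fin N ↔ V → (S : Cover C Adj V) → Coloured S arc

pull : ∀ {C D : Set} {Adj : C → C → Set} {Adj′ : D → D → Set} {V} (f : D → C) →
       (∀ {i j} → Adj′ i j → Adj (f i) (f j)) → Cover C Adj V → Cover D Adj′ V
pull f h S = record
  { mate = λ i j → mate (f i) (f j) ; mate-mate = λ a → mate-mate (h a)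
  ; out  = λ i j → out (f i) (f j)  ; out-mate = λ a → out-mate (h a) }
  where open Cover S

K : ∀ ℓ → Fin ℓ → Fin ℓ → Set
K ℓ i j = i ≢ j

K× : ∀ k ℓ → Fin k × Fin ℓ → Fin k × Fin ℓ → Set
K× k ℓ (i , a) (j , b) = i ≢ j × a ≢ b

-- Bit vectors

Bits : ℕ → Set
Bits zero    = ⊤
Bits (suc r) = Bool × Bits r

bits-size : ∀ r → Fin (2 ^ r) ↔ Bits r
bits-size zero    = 1↔⊤
bits-size (suc r) = (2↔Bool ×-↔ bits-size r) ↔-∘ *↔×

bit : ∀ {r} → Bits r → Fin r → Bool
bit (b , v) zero    = b
bit (b , v) (suc i) = bit v i

build : ∀ {r} → (Fin r → Bool) → Bits r
build {zero}  f = tt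
build {suc r} f = f zero , build (λ i → f (suc i))

bit-build : ∀ {r} (f : Fin r → Bool) i → bit (build f) i ≡ f i
bit-build f zero    = refl
bit-build f (suc i) = bit-build (λ j → f (suc j)) i

everyBits : ∀ {r} → (Bits r → Bool) → Bool
everyBits {zero}  f = f tt
everyBits {suc r} f = both λ b → everyBits λ v → f (b , v)

everyBits-at : ∀ {r} (f : Bits r → Bool) → everyBits f ≡ true → ∀ v → f v ≡ true
everyBits-at {zero}  f h tt      = h
everyBits-at {suc r} f h (b , v) = everyBits-at (λ v → f (b , v)) (both-at (λ b → everyBits λ v → f (b , v)) h b) v

-- Every vertex stores its arcs to the classes its own class records.
module Recording {C : Set} {Adj : C → C → Set} {c} (C-size : Fin c ↔ C) {r}
  (rec : C → C → Maybe (Fin r)) (target : C → Fin r → C)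
  (recorded : ∀ {i j} → Adj i j →
     (∃ λ t → rec i j ≡ just t × target i t ≡ j × rec j i ≡ nothing) ⊎
     (∃ λ t → rec j i ≡ just t × target j t ≡ i × rec i j ≡ nothing)) where

  decide : Maybe (Fin r) → Maybe (Fin r) → Bits r → Bits r → Bool
  decide (just t) nothing  v w = bit v t
  decide nothing  (just t) v w = not (bit w t)
  decide _        _        v w = false

  arc : C × Bits r → C × Bits r → Bool
  arc (i , v) (j , w) = decide (rec i j) (rec j i) v w

  asym : ∀ x y → arc x y ≡ true → ¬ arc y x ≡ true
  asym (i , v) (j , w) with rec i j | rec j i
  ... | just t  | nothing = not-both (bit v t)
  ... | nothing | just t  = λ h h′ → not-both (bit w t) h′ h

  colour : ∀ {V} (S : Cover C Adj V) → Coloured S arc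
  colour S = x , λ a u → ok a u (recorded a)
    where
    open Cover S
    x = λ i u → i , build (λ t → out i (target i t) u)
    ok : ∀ {i j} → Adj i j → ∀ u →
         (∃ λ t → rec i j ≡ just t × target i t ≡ j × rec j i ≡ nothing) ⊎
         (∃ λ t → rec j i ≡ just t × target j t ≡ i × rec i j ≡ nothing) →
         along arc (out i j u) (x i u) (x j (mate i j u)) ≡ true
    ok {i} {j} a u (inj₁ (t , e₁ , e , e₂)) = subst (λ s → along arc s (x i u) (x j (mate i j u)) ≡ true) s≡ (go (bit (build f) t) refl)
      where
      f = λ t → out i (target i t) u
      s≡ : bit (build f) t ≡ out i j u
      s≡ = trans (bit-build f t) (cong (λ k → out i k u) e)
      go : ∀ s → bit (build f) t ≡ s → along arc s (x i u) (x j (mate i j u)) ≡ true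
      go true  h rewrite e₁ | e₂ = h
      go false h rewrite e₁ | e₂ = cong not h
    ok {i} {j} a u (inj₂ (t , e₁ , e , e₂)) = subst (λ s → along arc s (x i u) (x j (mate i j u)) ≡ true) s≡ (go (bit (build f) t) refl)
      where
      f = λ t → out j (target j t) (mate i j u)
      s≡ : not (bit (build f) t) ≡ out i j u
      s≡ = trans (cong not (trans (bit-build f t) (trans (cong (λ k → out j k (mate i j u)) e) (out-mate a u)))) (not-involutive _)
      go : ∀ s → bit (build f) t ≡ s → along arc (not s) (x i u) (x j (mate i j u)) ≡ true
      go true  h rewrite e₁ | e₂ = h
      go false h rewrite e₁ | e₂ = cong not h

  universal : Universal C Adj (c * 2 ^ r)
  universal = record
    { X = C × Bits r ; size = (C-size ×-↔ bits-size r) ↔-∘ *↔× ; arc = arc ; asym = asym ; colour = λ _ → colour }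

-- Targets for more classes and more rows

module _ {ℓ m} (U : Universal (Fin ℓ) (K ℓ) m) where
  private module U = Universal U

  -- The new class becomes one vertex, and every old vertex stores one bit, its arc to that vertex.
  addClass : Universal (Fin (suc ℓ)) (K (suc ℓ)) (1 + 2 * m)
  addClass = record
    { X = ⊤ ⊎ (Bool × U.X)
    ; size = (1↔⊤ ⊎-↔ ((2↔Bool ×-↔ U.size) ↔-∘ *↔×)) ↔-∘ +↔⊎
    ; arc = arc ; asym = asym ; colour = colour }
    where
    arc : ⊤ ⊎ (Bool × U.X) → ⊤ ⊎ (Bool × U.X) → Bool
    arc (inj₁ _)       (inj₁ _)       = false
    arc (inj₁ _)       (inj₂ (s , x)) = s
    arc (inj₂ (s , x)) (inj₁ _)       = not s
    arc (inj₂ (s , x)) (inj₂ (t , y)) = U.arc x y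
    asym : ∀ x y → arc x y ≡ true → ¬ arc y x ≡ true
    asym (inj₁ _)       (inj₂ (s , x)) = not-both s
    asym (inj₂ (s , x)) (inj₁ _)       = λ h h′ → not-both s h′ h
    asym (inj₂ (s , x)) (inj₂ (t , y)) = U.asym x y
    colour : ∀ {V N} → Fin N ↔ V → (S : Cover (Fin (suc ℓ)) (K (suc ℓ)) V) → Coloured S arc
    colour {V} fin S = x , ok
      where
      open Cover S
      sol = U.colour fin (pull suc (λ { i≢j refl → i≢j refl }) S)
      x : Fin (suc ℓ) → V → ⊤ ⊎ (Bool × U.X)
      x zero    u = inj₁ tt
      x (suc i) u = inj₂ (not (out (suc i) zero u) , proj₁ sol i u)
      down : ∀ i → Respects S arc x zero (suc i)
      down i u rewrite out-mate {zero} {suc i} (λ ()) u with out zero (suc i) u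
      ... | true  = refl
      ... | false = refl
      ok : ∀ {i j} → i ≢ j → Respects S arc x i j
      ok {zero}  {zero}  i≢j u = ⊥-elim (i≢j refl)
      ok {zero}  {suc j} i≢j = down j
      ok {suc i} {zero}  i≢j = respects-sym S arc x {zero} {suc i} (λ ()) (λ ()) (down i)
      ok {suc i} {suc j} i≢j u with out (suc i) (suc j) u | proj₂ sol {i} {j} (λ { refl → i≢j refl }) u
      ... | true  | h = h
      ... | false | h = h

flip₂ : Fin 2 → Fin 2
flip₂ zero       = suc zero
flip₂ (suc zero) = zero

flip₂-flip₂ : ∀ i → flip₂ (flip₂ i) ≡ i
flip₂-flip₂ zero       = refl
flip₂-flip₂ (suc zero) = refl

flip₂-≢ : ∀ i → i ≢ flip₂ i
flip₂-≢ zero       ()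
flip₂-≢ (suc zero) ()

≢-flip₂ : ∀ {i j : Fin 2} → i ≢ j → j ≡ flip₂ i
≢-flip₂ {zero}     {zero}     h = ⊥-elim (h refl)
≢-flip₂ {zero}     {suc zero} h = refl
≢-flip₂ {suc zero} {zero}     h = refl
≢-flip₂ {suc zero} {suc zero} h = ⊥-elim (h refl)

-- Of two rows, a neighbour always lies in the other one, so the row can be moved from the class
-- into the vertex: the cover becomes one of `K ℓ` over `Fin 2 × V`.
double : ∀ {ℓ m} → Universal (Fin ℓ) (K ℓ) m → Universal (Fin 2 × Fin ℓ) (K× 2 ℓ) m
double {ℓ} U = record { X = U.X ; size = U.size ; arc = U.arc ; asym = U.asym ; colour = colour }
  where
  module U = Universal U
  colour : ∀ {V N} → Fin N ↔ V → (S : Cover (Fin 2 × Fin ℓ) (K× 2 ℓ) V) → Coloured S U.arc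
  colour {V} {N} fin S = (λ (i , a) u → proj₁ sol a (i , u)) , λ { {i , a} {j , b} → ok i j a b }
    where
    open Cover S
    S′ : Cover (Fin ℓ) (K ℓ) (Fin 2 × V)
    S′ = record
      { mate = λ a b (i , u) → flip₂ i , mate (i , a) (flip₂ i , b) u
      ; mate-mate = λ { {a} {b} a≢b (i , u) → cong₂ _,_ (flip₂-flip₂ i)
          (trans (cong (λ j → mate (flip₂ i , b) (j , a) (mate (i , a) (flip₂ i , b) u)) (flip₂-flip₂ i)) (mate-mate (flip₂-≢ i , a≢b) u)) }
      ; out = λ a b (i , u) → out (i , a) (flip₂ i , b) u
      ; out-mate = λ { {a} {b} a≢b (i , u) →
          trans (cong (λ j → out (flip₂ i , b) (j , a) (mate (i , a) (flip₂ i , b) u)) (flip₂-flip₂ i)) (out-mate (flip₂-≢ i , a≢b) u) } }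
    sol = U.colour ((↔-id (Fin 2) ×-↔ fin) ↔-∘ *↔× {2} {N}) S′
    ok : ∀ i j a b → K× 2 ℓ (i , a) (j , b) → ∀ u →
         along U.arc (out (i , a) (j , b) u) (proj₁ sol a (i , u)) (proj₁ sol b (j , mate (i , a) (j , b) u)) ≡ true
    ok i j a b (i≢j , a≢b) u with ≢-flip₂ i≢j
    ... | refl = proj₂ sol a≢b (i , u)

parity : ∀ {r} → Bits r → Bool
parity {zero}  v       = false
parity {suc r} (b , v) = b xor parity v

-- The coordinates 1 … r are stored, coordinate 0 makes the total parity even.
coord : ∀ {r} → Bits r → Fin (suc r) → Bool
coord v zero    = parity v
coord v (suc i) = bit v i

xor-cancel : ∀ a b → (a xor b) xor b ≡ a
xor-cancel false false = refl
xor-cancel false true  = refl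
xor-cancel true  false = refl
xor-cancel true  true  = refl

xor-shift : ∀ a b → a xor (a xor b) ≡ b
xor-shift false b = refl
xor-shift true  false = refl
xor-shift true  true = refl

-- Coordinate `i` is exempt from agreeing with `d` and is spent on reaching the parity `p`.
fillParity : ∀ {r} (d : Fin r → Bool) (i : Fin r) (p : Bool) →
             Σ (Bits r) λ v → parity v ≡ p × ∀ j → i ≢ j → bit v j ≡ d j
fillParity {suc r} d zero p = ((p xor parity v) , v) , xor-cancel p (parity v) ,
  λ { zero h → ⊥-elim (h refl) ; (suc j) h → bit-build _ j }
  where v = build (λ j → d (suc j))
fillParity {suc r} d (suc i) p with fillParity (λ j → d (suc j)) i (d zero xor p)
... | v , par , ok = (d zero , v) , trans (cong (d zero xor_) par) (xor-shift (d zero) p) ,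
  λ { zero h → refl ; (suc j) h → ok j (λ e → h (cong suc e)) }

-- An even-weight vector of length `suc r` can be prescribed off any one coordinate, so `r` bits
-- suffice whichever coordinate is exempt.
fill : ∀ {r} (d : Fin (suc r) → Bool) (i : Fin (suc r)) → Σ (Bits r) λ v → ∀ j → i ≢ j → coord v j ≡ d j
fill d zero = build (λ j → d (suc j)) , λ { zero h → ⊥-elim (h refl) ; (suc j) h → bit-build _ j }
fill d (suc i) with fillParity (λ j → d (suc j)) i (d zero)
... | v , par , ok = v , λ { zero h → par ; (suc j) h → ok j (λ e → h (cong suc e)) }

module _ {k r m} (U : Universal (Fin k × Fin (suc r)) (K× k (suc r)) m) where
  private module U = Universal U

  addRow : Universal (Fin (suc k) × Fin (suc r)) (K× (suc k) (suc r)) (suc r + 2 ^ r * m)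
  addRow = record
    { X = X ; size = (↔-id (Fin (suc r)) ⊎-↔ ((bits-size r ×-↔ U.size) ↔-∘ *↔×)) ↔-∘ +↔⊎
    ; arc = arc ; asym = asym ; colour = colour }
    where
    X : Set
    X = Fin (suc r) ⊎ (Bits r × U.X)
    arc : X → X → Bool
    arc (inj₁ a)       (inj₁ b)       = false
    arc (inj₁ a)       (inj₂ (v , x)) = coord v a
    arc (inj₂ (v , x)) (inj₁ a)       = not (coord v a)
    arc (inj₂ (v , x)) (inj₂ (w , y)) = U.arc x y
    asym : ∀ x y → arc x y ≡ true → ¬ arc y x ≡ true
    asym (inj₁ a)       (inj₂ (v , x)) = not-both (coord v a)
    asym (inj₂ (v , x)) (inj₁ a)       = λ h h′ → not-both (coord v a) h′ h
    asym (inj₂ (v , x)) (inj₂ (w , y)) = U.asym x y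
    colour : ∀ {V N} → Fin N ↔ V → (S : Cover (Fin (suc k) × Fin (suc r)) (K× (suc k) (suc r)) V) → Coloured S arc
    colour {V} fin S = x , λ { {i , a} {j , b} → ok {i} {a} {j} {b} }
      where
      open Cover S
      sol = U.colour fin (pull (λ (i , a) → suc i , a) (λ (p , q) → (λ { refl → p refl }) , q) S)
      -- Class `(suc i , a)` is not adjacent to `(zero , a)`, so coordinate `a` is the exempt one.
      label : ∀ i a u → Σ (Bits r) λ v → ∀ b → a ≢ b → coord v b ≡ not (out (suc i , a) (zero , b) u)
      label i a u = fill (λ b → not (out (suc i , a) (zero , b) u)) a
      x : Fin (suc k) × Fin (suc r) → V → X
      x (zero  , a) u = inj₁ a
      x (suc i , a) u = inj₂ (proj₁ (label i a u) , proj₁ sol (i , a) u)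
      down : ∀ {a i b} → a ≢ b → Respects S arc x (zero , a) (suc i , b)
      down {a} {i} {b} a≢b u with out (zero , a) (suc i , b) u | mate (zero , a) (suc i , b) u | out-mate {zero , a} {suc i , b} ((λ ()) , a≢b) u
      ... | true  | w | e = trans (proj₂ (label i b w) a (λ e → a≢b (sym e))) (cong not e)
      ... | false | w | e = cong not (trans (proj₂ (label i b w) a (λ e → a≢b (sym e))) (cong not e))
      ok : ∀ {i a j b} → i ≢ j × a ≢ b → Respects S arc x (i , a) (j , b)
      ok {zero}  {a} {zero}  {b} (p , q) = ⊥-elim (p refl)
      ok {zero}  {a} {suc j} {b} (p , q) = down q
      ok {suc i} {a} {zero}  {b} (p , q) =
        respects-sym S arc x {zero , b} {suc i , a} ((λ ()) , λ e → q (sym e)) ((λ ()) , q) (down (λ e → q (sym e)))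
      ok {suc i} {a} {suc j} {b} (p , q) u with out (suc i , a) (suc j , b) u | proj₂ sol {i , a} {j , b} ((λ { refl → p refl }) , q) u
      ... | true  | h = h
      ... | false | h = h

next₃ : Fin 3 → Fin 3
next₃ zero             = suc zero
next₃ (suc zero)       = suc (suc zero)
next₃ (suc (suc zero)) = zero

next₃-cases : ∀ i j → i ≢ j → (j ≡ next₃ i × i ≢ next₃ j) ⊎ (i ≡ next₃ j × j ≢ next₃ i)
next₃-cases zero zero h = ⊥-elim (h refl)
next₃-cases zero (suc zero) h = inj₁ (refl , λ ())
next₃-cases zero (suc (suc zero)) h = inj₂ (refl , λ ())
next₃-cases (suc zero) zero h = inj₂ (refl , λ ())
next₃-cases (suc zero) (suc zero) h = ⊥-elim (h refl)
next₃-cases (suc zero) (suc (suc zero)) h = inj₁ (refl , λ ())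
next₃-cases (suc (suc zero)) zero h = inj₁ (refl , λ ())
next₃-cases (suc (suc zero)) (suc zero) h = inj₂ (refl , λ ())
next₃-cases (suc (suc zero)) (suc (suc zero)) h = ⊥-elim (h refl)

-- The rows are put in cyclic order, and a vertex in column `a` records its `r` neighbours in the
-- next row; `punchIn a` enumerates their columns.
threeRows : ∀ r → Universal (Fin 3 × Fin (suc r)) (K× 3 (suc r)) (3 * suc r * 2 ^ r)
threeRows r = Recording.universal *↔× rec (λ (i , a) t → next₃ i , punchIn a t) (λ { {i , a} {j , b} → recorded i a j b })
  where
  rec : Fin 3 × Fin (suc r) → Fin 3 × Fin (suc r) → Maybe (Fin r)
  rec (i , a) (j , b) with j ≟ next₃ i | a ≟ b
  ... | yes _ | no a≢b = just (punchOut a≢b)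
  ... | _     | _      = nothing
  yes-case : ∀ i a j b → j ≡ next₃ i → a ≢ b → ∃ λ t → rec (i , a) (j , b) ≡ just t × (next₃ i , punchIn a t) ≡ (j , b)
  yes-case i a j b e a≢b with j ≟ next₃ i | a ≟ b
  ... | yes refl | no a≢b′ = punchOut a≢b′ , refl , cong (next₃ i ,_) (punchIn-punchOut a≢b′)
  ... | yes _    | yes e′  = ⊥-elim (a≢b e′)
  ... | no h     | _       = ⊥-elim (h e)
  no-case : ∀ i a j b → j ≢ next₃ i → rec (i , a) (j , b) ≡ nothing
  no-case i a j b h with j ≟ next₃ i | a ≟ b
  ... | yes e | no _  = ⊥-elim (h e)
  ... | yes e | yes _ = refl
  ... | no _  | _     = refl
  recorded : ∀ i a j b → i ≢ j × a ≢ b → _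
  recorded i a j b (p , q) with next₃-cases i j p
  ... | inj₁ (e , h) with yes-case i a j b e q
  ...   | t , e₁ , e₂ = inj₁ (t , e₁ , e₂ , no-case j b i a h)
  recorded i a j b (p , q) | inj₂ (e , h) with yes-case j b i a e (λ e → q (sym e))
  ...   | t , e₁ , e₂ = inj₂ (t , e₁ , e₂ , no-case i a j b h)

-- Cycles through three classes

Row : ℕ → Set
Row n = Vec Bool n

Mat : ℕ → Set
Mat n = Vec (Row n) n

at : ∀ {n} → Mat n → Fin n → Fin n → Bool
at m x y = lookup (lookup m x) y

image : ∀ {k n} → Row k → Vec (Row n) k → Row n
image []          []       = replicate _ false
image (true  ∷ s) (r ∷ rs) = zipWith _∨_ r (image s rs)
image (false ∷ s) (r ∷ rs) = image s rs

image-pre : ∀ {k n} (s : Row k) (rs : Vec (Row n) k) y → lookup (image s rs) y ≡ true →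
            ∃ λ x → lookup s x ≡ true × lookup (lookup rs x) y ≡ true
image-pre [] [] y h with trans (sym (lookup-replicate y false)) h
... | ()
image-pre (true ∷ s) (r ∷ rs) y h with ∨-split (trans (sym (lookup-zipWith _∨_ y r (image s rs))) h)
... | inj₁ ry = zero , refl , ry
... | inj₂ h′ with image-pre s rs y h′
...   | x , sx , rxy = suc x , sx , rxy
image-pre (false ∷ s) (r ∷ rs) y h with image-pre s rs y h
... | x , sx , rxy = suc x , sx , rxy

-- Rows are sets of elements and matrices are relations: this is composition of relations, with the
-- end points confined to the mask `K`.
step : ∀ {k n} → Vec (Row n) k → Mat n → Row n → Vec (Row n) k
step m t K = map (λ r → zipWith _∧_ K (image r t)) m

step-mid : ∀ {k n} (m : Vec (Row n) k) (t : Mat n) K x z → lookup (lookup (step m t K) x) z ≡ true →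
           ∃ λ y → lookup (lookup m x) y ≡ true × at t y z ≡ true × lookup K z ≡ true
step-mid m t K x z h
  with ∧-split (trans (sym (lookup-zipWith _∧_ z K (image (lookup m x) t)))
                 (trans (cong (λ r → lookup r z) (sym (lookup-map x (λ r → zipWith _∧_ K (image r t)) m))) h))
... | Kz , h′ with image-pre (lookup m x) t z h′
...   | y , xy , yz = y , xy , yz , Kz

does-≡ : ∀ {n} (x z : Fin n) → does (x ≟ z) ≡ true → x ≡ z
does-≡ x z h with x ≟ z
... | yes e = e

point : ∀ {n} → Fin n → Row n
point x = tabulate (λ z → does (x ≟ z))

points-≡ : ∀ {k n} (xs : Vec (Fin n) k) i z → lookup (lookup (map point xs) i) z ≡ true → lookup xs i ≡ z
points-≡ xs i z h = does-≡ _ z (trans (sym (lookup∘tabulate (λ z → does (lookup xs i ≟ z)) z))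
  (trans (cong (λ r → lookup r z) (sym (lookup-map i point xs))) h))

_⇒ᵇ_ : Bool → Bool → Bool
true  ⇒ᵇ b = b
false ⇒ᵇ b = true

rowLe : ∀ {n} → Row n → Row n → Bool
rowLe []      []      = true
rowLe (a ∷ r) (b ∷ s) = (a ⇒ᵇ b) ∧ rowLe r s

matLe : ∀ {k n} → Vec (Row n) k → Vec (Row n) k → Bool
matLe []      []        = true
matLe (r ∷ m) (r′ ∷ m′) = rowLe r r′ ∧ matLe m m′

rowLe-at : ∀ {n} (r s : Row n) → rowLe r s ≡ true → ∀ y → lookup r y ≡ true → lookup s y ≡ true
rowLe-at (true ∷ r) (b ∷ s) h zero    refl = proj₁ (∧-split h)
rowLe-at (a ∷ r)    (b ∷ s) h (suc y) e    = rowLe-at r s (proj₂ (∧-split {a ⇒ᵇ b} h)) y e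

matLe-at : ∀ {k n} (m m′ : Vec (Row n) k) → matLe m m′ ≡ true → ∀ x y →
           lookup (lookup m x) y ≡ true → lookup (lookup m′ x) y ≡ true
matLe-at (r ∷ m) (r′ ∷ m′) h zero    y e = rowLe-at r r′ (proj₁ (∧-split h)) y e
matLe-at (r ∷ m) (r′ ∷ m′) h (suc x) y e = matLe-at m m′ (proj₂ (∧-split {rowLe r r′} h)) x y e

-- Only some rows of a relation are kept, and `f` names the element each kept row belongs to; a hit
-- is a fixed point.
traced : ∀ {k n} → Vec (Row n) k → (Fin k → Fin n) → Bool
traced []      f = false
traced (r ∷ m) f = lookup r (f zero) ∨ traced m (λ i → f (suc i))

traced-at : ∀ {k n} (m : Vec (Row n) k) f → traced m f ≡ true → ∃ λ x → lookup (lookup m x) (f x) ≡ true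
traced-at (r ∷ m) f h with ∨-split h
... | inj₁ e = zero , e
... | inj₂ h′ with traced-at m (λ i → f (suc i)) h′
...   | x , e = suc x , e

-- A permutation whose arrows carry composable relations, all closed composites of which have a
-- fixed point, can be solved by removing its vertices one at a time: the two arrows at the removed
-- vertex are composed.
module _ {O E : Set} (Path : O → O → Set) (Walk : ∀ {o o′} → Path o o′ → E → E → Set)
         (_▹_ : ∀ {o o′ o″} → Path o o′ → Path o′ o″ → Path o o″)
         (cut : ∀ {o o′ o″} (p : Path o o′) (q : Path o′ o″) {x z} → Walk (p ▹ q) x z → ∃ λ y → Walk p x y × Walk q y z)
         (closed : ∀ {o} (p : Path o o) → ∃ λ x → Walk p x x) where

  bypassAt : ∀ {n} → Fin n → Fin (suc n) → Fin (suc n) → Fin n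
  bypassAt u (suc v) _       = v
  bypassAt u zero    (suc v) = v
  -- A dummy value: for injective `σ`, the vertices `zero` and `suc u` cannot both be sent to
  -- `zero`.
  bypassAt u zero    zero    = u

  bypass : ∀ {n} → (Fin (suc n) → Fin (suc n)) → Fin n → Fin n
  bypass σ u = bypassAt u (σ (suc u)) (σ zero)

  bypass-inverse : ∀ {n} (σ τ : Fin (suc n) → Fin (suc n)) → (∀ u → τ (σ u) ≡ u) →
                   ∀ u → bypass τ (bypass σ u) ≡ u
  bypass-inverse σ τ τσ u = go (σ (suc u)) (σ zero) refl refl
    where
    go : ∀ s s₀ → σ (suc u) ≡ s → σ zero ≡ s₀ → bypass τ (bypassAt u s s₀) ≡ u
    go (suc v) _ e _ rewrite trans (cong τ (sym e)) (τσ (suc u)) = refl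
    go zero (suc v) e e₀ rewrite trans (cong τ (sym e₀)) (τσ zero) | trans (cong τ (sym e)) (τσ (suc u)) = refl
    go zero zero e e₀ with trans (sym (τσ (suc u))) (trans (cong τ (trans e (sym e₀))) (τσ zero))
    ... | ()

  assign : ∀ n (σ τ : Fin n → Fin n) → (∀ u → τ (σ u) ≡ u) → (∀ u → σ (τ u) ≡ u) →
           (obj : Fin n → O) (p : ∀ u → Path (obj u) (obj (σ u))) →
           Σ (Fin n → E) λ x → ∀ u → Walk (p u) (x u) (x (σ u))
  assign zero    σ τ τσ στ obj p = (λ ()) , λ ()
  assign (suc n) σ τ τσ στ obj p = finish (σ zero) refl (τ zero) refl
    where
    -- Arrows are indexed by a proof of where `σ` leads, so cases on that value leave `p` untouched;
    -- `uip` later identifies different proofs.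
    path : ∀ {u v} → σ u ≡ v → Path (obj u) (obj v)
    path refl = p _

    σ-injective : ∀ {u v w} → σ u ≡ w → σ v ≡ w → u ≡ v
    σ-injective {u} {v} e e′ = trans (sym (τσ u)) (trans (cong τ (trans e (sym e′))) (τσ v))

    linkAt : ∀ u s s₀ → σ (suc u) ≡ s → σ zero ≡ s₀ → Path (obj (suc u)) (obj (suc (bypassAt u s s₀)))
    linkAt u (suc v) _       e e₀ = path e
    linkAt u zero    (suc v) e e₀ = path e ▹ path e₀
    linkAt u zero    zero    e e₀ with σ-injective e e₀
    ... | ()

    rest : Σ (Fin n → E) λ y → ∀ u → Walk (linkAt u _ _ refl refl) (y u) (y (bypass σ u))
    rest = assign n (bypass σ) (bypass τ) (bypass-inverse σ τ τσ) (bypass-inverse τ σ στ)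
                  (λ u → obj (suc u)) (λ u → linkAt u _ _ refl refl)

    y : Fin n → E
    y = proj₁ rest

    linked : ∀ u s s₀ (e : σ (suc u) ≡ s) (e₀ : σ zero ≡ s₀) → Walk (linkAt u s s₀ e e₀) (y u) (y (bypassAt u s s₀))
    linked u _ _ refl refl = proj₂ rest u

    ext : E → Fin (suc n) → E
    ext x₀ zero    = x₀
    ext x₀ (suc u) = y u

    Sound : E → Set
    Sound x₀ = ∀ u v (e : σ u ≡ v) → Walk (path e) (ext x₀ u) (ext x₀ v)

    done : ∃ Sound → Σ (Fin (suc n) → E) λ x → ∀ u → Walk (p u) (x u) (x (σ u))
    done (x₀ , sound) = ext x₀ , λ u → sound u _ refl

    finish : ∀ s₀ → σ zero ≡ s₀ → ∀ t₀ → τ zero ≡ t₀ → Σ (Fin (suc n) → E) λ x → ∀ u → Walk (p u) (x u) (x (σ u))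
    -- A fixed vertex forms a cycle of its own, which `closed` solves independently of the rest.
    finish zero e₀ _ _ = done (proj₁ loop , sound)
      where
      loop = closed (path e₀)
      sound : Sound (proj₁ loop)
      sound zero    zero    e = subst (λ q → Walk (path q) (proj₁ loop) (proj₁ loop)) (uip e₀ e) (proj₂ loop)
      sound zero    (suc v) e with trans (sym e₀) e
      ... | ()
      sound (suc u) zero    e with σ-injective e e₀
      ... | ()
      sound (suc u) (suc v) e = linked u (suc v) _ e refl
    finish (suc v₀) e₀ zero t₀ with trans (sym e₀) (trans (cong σ (sym t₀)) (στ zero))
    ... | ()
    -- The solution without `zero` satisfies the composite arrow from `suc u₀` to `suc v₀`; the
    -- point where `cut` divides it is the value at `zero`.
    finish (suc v₀) e₀ (suc u₀) t₀ = done (x₀ , sound)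
      where
      e₁ : σ (suc u₀) ≡ zero
      e₁ = trans (cong σ (sym t₀)) (στ zero)
      split = cut (path e₁) (path e₀) (linked u₀ zero (suc v₀) e₁ e₀)
      x₀ = proj₁ split
      sound : Sound x₀
      sound zero    zero    e with trans (sym e₀) e
      ... | ()
      sound zero    (suc v) e with trans (sym e₀) e
      ... | refl = subst (λ q → Walk (path q) x₀ (y v)) (uip e₀ e) (proj₂ (proj₂ split))
      sound (suc u) zero    e with σ-injective e e₁
      ... | refl = subst (λ q → Walk (path q) (y u) x₀) (uip e₁ e) (proj₁ (proj₂ split))
      sound (suc u) (suc v) e = linked u (suc v) _ e refl

-- T true and T false are the adjacency matrix of the target and its transpose. Every vertex of the
-- classes A, B, C is restricted to the elements of one of the masks of its class. Going round
-- A → B → C → A composes relations on the elements; family o o′ is to contain, for every such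
-- composite between vertices with masks o and o′, a relation below it (restricted to the rows in
-- starts o).
module Hexagon (n k a b c : ℕ) (T : Bool → Mat n) (starts : Fin a → Vec (Fin n) k)
               (maskA : Fin a → Row n) (maskB : Fin b → Row n) (maskC : Fin c → Row n)
               (family : Fin a → Fin a → List (Vec (Row n) k)) where

  -- `fromA`, `fromB` and `fromC` follow the rest of a lap from the class named, for every mask and
  -- both directions of each arc, until it returns to A above a member of the family.
  fromC : Fin a → Vec (Row n) k → Bool
  fromC o m = every λ o′ → both λ s → someIn (λ m′ → matLe m′ (step m (T s) (maskA o′))) (family o o′)

  fromB : Fin a → Vec (Row n) k → Bool
  fromB o m = every λ q → both λ s → fromC o (step m (T s) (maskC q))

  fromA : Fin a → Vec (Row n) k → Bool
  fromA o m = every λ p → both λ s → fromB o (step m (T s) (maskB p))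

  stable : Bool
  stable = every λ o → fromA o (map point (starts o)) ∧ every λ o′ → everyIn (fromA o) (family o o′)

  looping : Bool
  looping = every λ o → everyIn (λ m → traced m (lookup (starts o))) (family o o)

  Step : Bool → Row n → Fin n → Fin n → Set
  Step s K x y = at (T s) x y ≡ true × lookup K y ≡ true

  record Certified : Set where
    field
      isStable  : stable ≡ true
      isLooping : looping ≡ true

  module _ (certificate : Certified) where
    open Certified certificate

    -- Formal composites of laps A → B → C → A; a `seg` lists the masks entered and the directions
    -- of the three arcs. With composition a constructor, cutting a walk is immediate.
    data Path : Fin a → Fin a → Set where
      seg : ∀ {o} o′ → Fin b → Bool → Fin c → Bool → Bool → Path o o′
      _▹_ : ∀ {o o′ o″} → Path o o′ → Path o′ o″ → Path o o″

    Walk : ∀ {o o′} → Path o o′ → Fin n → Fin n → Set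
    Walk (seg o′ p s q t r) x z = ∃ λ y → ∃ λ w → Step s (maskB p) x y × Step t (maskC q) y w × Step r (maskA o′) w z
    Walk (p ▹ q)            x z = ∃ λ y → Walk p x y × Walk q y z

    Below : Fin a → Vec (Row n) k → (Fin n → Fin n → Set) → Set
    Below o m R = ∀ x z → lookup (lookup m x) z ≡ true → R (lookup (starts o) x) z

    stable-at : ∀ o → (fromA o (map point (starts o)) ∧ every λ o′ → everyIn (fromA o) (family o o′)) ≡ true
    stable-at = every-at (λ o → fromA o (map point (starts o)) ∧ every λ o′ → everyIn (fromA o) (family o o′)) isStable

    family-stable : ∀ {o o′ m} → m ∈ family o o′ → fromA o m ≡ true
    family-stable {o} {o′} = everyIn-at (fromA o)
      (every-at (λ o′ → everyIn (fromA o) (family o o′)) (proj₂ (∧-split {fromA o (map point (starts o))} (stable-at o))) o′)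

    -- `R` is what has been walked so far and `m` a lower bound for it that passes the check.
    -- Keeping `R` arbitrary handles every bracketing: follow `p`, then `q` from the family member
    -- reached.
    extend : ∀ {o o′ o″} (R : Fin n → Fin n → Set) {m} → fromA o m ≡ true → Below o m R → (p : Path o′ o″) →
             ∃ λ m′ → m′ ∈ family o o″ × Below o m′ (λ x z → ∃ λ y → R x y × Walk p y z)
    extend {o} {o′} R {m} check₁ below (seg o″ p s q t r) = m′ , proj₁ (proj₂ found) , below′
      where
      check₂ = both-at (λ s → fromB o (step m (T s) (maskB p))) (every-at (λ p → both λ s → fromB o (step m (T s) (maskB p))) check₁ p) s
      m₁ = step m (T s) (maskB p)
      check₃ = both-at (λ t → fromC o (step m₁ (T t) (maskC q))) (every-at (λ q → both λ t → fromC o (step m₁ (T t) (maskC q))) check₂ q) t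
      m₂ = step m₁ (T t) (maskC q)
      check₄ = both-at (λ r → someIn (λ m′ → matLe m′ (step m₂ (T r) (maskA o″))) (family o o″))
                 (every-at (λ o″ → both λ r → someIn (λ m′ → matLe m′ (step m₂ (T r) (maskA o″))) (family o o″)) check₃ o″) r
      found = someIn-find (λ m′ → matLe m′ (step m₂ (T r) (maskA o″))) (family o o″) check₄
      m′ = proj₁ found
      below′ : Below o m′ (λ x z → ∃ λ y → R x y × Walk (seg {o′} o″ p s q t r) y z)
      below′ x z h with step-mid m₂ (T r) (maskA o″) x z (matLe-at m′ _ (proj₂ (proj₂ found)) x z h)
      ... | w , xw , wz with step-mid m₁ (T t) (maskC q) x w xw
      ...   | y , xy , yw with step-mid m (T s) (maskB p) x y xy
      ...     | v , xv , vy = v , below x v xv , y , w , vy , yw , wz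
    extend R check below (p ▹ q) with extend R check below p
    ... | m₁ , m₁∈ , below₁ with extend (λ x y → ∃ λ v → R x v × Walk p v y) (family-stable m₁∈) below₁ q
    ...   | m₂ , m₂∈ , below₂ = m₂ , m₂∈ , λ x z h → regroup (below₂ x z h)
      where
      regroup : ∀ {x z} → (∃ λ y → (∃ λ v → R x v × Walk p v y) × Walk q y z) → ∃ λ v → R x v × ∃ λ y → Walk p v y × Walk q y z
      regroup (y , (v , xv , vy) , yz) = v , xv , y , vy , yz

    -- Walking on from the identity on `starts o` ends above a member of `family o o`, and `looping`
    -- gives each of these a fixed point.
    closed : ∀ {o} (p : Path o o) → ∃ λ x → Walk p x x
    closed {o} p with extend _≡_ (proj₁ (∧-split (stable-at o))) (points-≡ (starts o)) p
    ... | m , m∈ , below with traced-at m (lookup (starts o)) (everyIn-at (λ m → traced m (lookup (starts o)))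
      (every-at (λ o → everyIn (λ m → traced m (lookup (starts o))) (family o o)) isLooping o) m∈)
    ...   | x , h with below x _ h
    ...     | _ , refl , w = _ , w

    -- One lap around the three classes is a permutation of class A, to which `assign` applies;
    -- `conj` carries it to `Fin N`.
    solve : ∀ {V : Set} {N} → Fin N ↔ V →
            (ab ba bc cb ca ac : V → V) →
            (∀ v → ba (ab v) ≡ v) → (∀ v → ab (ba v) ≡ v) → (∀ v → cb (bc v) ≡ v) → (∀ v → bc (cb v) ≡ v) →
            (∀ v → ac (ca v) ≡ v) → (∀ v → ca (ac v) ≡ v) →
            (la : V → Fin a) (lb : V → Fin b) (lc : V → Fin c) (s t r : V → Bool) →
            Σ (V → Fin n) λ xa → Σ (V → Fin n) λ xb → Σ (V → Fin n) λ xc →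
            (∀ v → Step (s v) (maskB (lb (ab v))) (xa v) (xb (ab v))) ×
            (∀ v → Step (t v) (maskC (lc (bc v))) (xb v) (xc (bc v))) ×
            (∀ v → Step (r v) (maskA (la (ca v))) (xc v) (xa (ca v)))
    solve {V} {N} fin ab ba bc cb ca ac baab abba cbbc bccb acca caac la lb lc s t r =
      xa , xb , xc , okAB , okBC , okCA
      where
      open Inverse fin
      σ τ : V → V
      σ v = ca (bc (ab v))
      τ v = ba (cb (ac v))
      τσ : ∀ v → τ (σ v) ≡ v
      τσ v = trans (cong (λ w → ba (cb w)) (acca _)) (trans (cong ba (cbbc _)) (baab v))
      στ : ∀ v → σ (τ v) ≡ v
      στ v = trans (cong (λ w → ca (bc w)) (abba _)) (trans (cong ca (bccb _)) (caac v))
      path : ∀ v → Path (la v) (la (σ v))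
      path v = seg (la (σ v)) (lb (ab v)) (s v) (lc (bc (ab v))) (t (ab v)) (r (bc (ab v)))
      conj : (V → V) → Fin N → Fin N
      conj f i = from (f (to i))
      conj-inverse : ∀ f g → (∀ v → g (f v) ≡ v) → ∀ i → conj g (conj f i) ≡ i
      conj-inverse f g gf i = trans (cong (λ w → from (g w)) (strictlyInverseˡ _)) (trans (cong from (gf _)) (strictlyInverseʳ i))
      pathFin : ∀ i → Path (la (to i)) (la (to (conj σ i)))
      pathFin i = subst (λ w → Path (la (to i)) (la w)) (sym (strictlyInverseˡ _)) (path (to i))
      sol = assign Path Walk _▹_ (λ p q w → w) closed N (conj σ) (conj τ)
                   (conj-inverse σ τ τσ) (conj-inverse τ σ στ) (λ i → la (to i)) pathFin
      xa : V → Fin n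
      xa v = proj₁ sol (from v)
      Walk-subst : ∀ {o} {v v′ : V} (e : v ≡ v′) (p : Path o (la v)) {x z} →
                   Walk (subst (λ w → Path o (la w)) e p) x z → Walk p x z
      Walk-subst refl p w = w
      walk : ∀ v → Walk (path v) (xa v) (xa (σ v))
      walk v = subst (λ w → Walk (path w) (xa v) (xa (σ w))) (strictlyInverseˡ v)
                 (Walk-subst (sym (strictlyInverseˡ _)) (path (to (from v))) (proj₂ sol (from v)))
      xb xc : V → Fin n
      -- Vertices of B and C take the intermediate points of the lap that passes through them.
      xb v = proj₁ (walk (ba v))
      xc v = proj₁ (proj₂ (walk (ba (cb v))))
      okAB : ∀ v → Step (s v) (maskB (lb (ab v))) (xa v) (xb (ab v))
      okAB v = subst (λ w → Step (s v) (maskB (lb (ab v))) (xa v) (proj₁ (walk w))) (sym (baab v))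
                 (proj₁ (proj₂ (proj₂ (walk v))))
      okBC : ∀ v → Step (t v) (maskC (lc (bc v))) (xb v) (xc (bc v))
      okBC v = subst₂ (λ w w′ → Step (t w) (maskC (lc (bc w))) (xb v) (proj₁ (proj₂ (walk (ba w′)))))
                 (abba v) (sym (cbbc v)) (proj₁ (proj₂ (proj₂ (proj₂ (walk (ba v))))))
      okCA : ∀ v → Step (r v) (maskA (la (ca v))) (xc v) (xa (ca v))
      okCA v = subst (λ w → Step (r w) (maskA (la (ca w))) (xc v) (xa (ca w)))
                 (trans (cong bc (abba _)) (bccb v)) (proj₂ (proj₂ (proj₂ (proj₂ (walk (ba (cb v)))))))

at-along : ∀ {n} (T : Bool → Mat n) → (∀ x y → at (T false) x y ≡ at (T true) y x) →
           ∀ s {x y} → at (T s) x y ≡ true → along (at (T true)) s x y ≡ true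
at-along T tr true  h = h
at-along T tr false {x} {y} h = trans (sym (tr x y)) h

transposed : ∀ {n} → (Bool → Mat n) → Bool
transposed T = every λ x → every λ y → at (T false) x y ⇔ᵇ at (T true) y x

transposed-at : ∀ {n} (T : Bool → Mat n) → transposed T ≡ true → ∀ x y → at (T false) x y ≡ at (T true) y x
transposed-at T h x y = ⇔ᵇ-≡ (every-at (λ y → at (T false) x y ⇔ᵇ at (T true) y x)
  (every-at (λ x → every λ y → at (T false) x y ⇔ᵇ at (T true) y x) h x) y)

-- Targets for covers of small complete graphs

-- A cover of `K 2` is a perfect matching: tails go to `true`, heads to `false`.
clique₂ : Universal (Fin 2) (K 2) 2
clique₂ = record { X = Bool ; size = 2↔Bool ; arc = λ x y → x ∧ not y ; asym = asym ; colour = λ _ → colour }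
  where
  asym : ∀ x y → x ∧ not y ≡ true → ¬ y ∧ not x ≡ true
  asym true false _ ()
  colour : ∀ {V} (S : Cover (Fin 2) (K 2) V) → Coloured S (λ x y → x ∧ not y)
  colour S = (λ i u → out i (flip₂ i) u) , λ {i} {j} h u → ok i j h u
    where
    open Cover S
    ok : ∀ i j → i ≢ j → ∀ u → along (λ x y → x ∧ not y) (out i j u) (out i (flip₂ i) u) (out j (flip₂ j) (mate i j u)) ≡ true
    ok i j h u with ≢-flip₂ h
    ... | refl rewrite flip₂-flip₂ i | out-mate h u with out i (flip₂ i) u
    ...   | true  = refl
    ...   | false = refl

pattern 𝟎 = false
pattern 𝟏 = true

-- A directed triangle and a source dominating it.
T₄ : Bool → Mat 4
T₄ true =
  (𝟎 ∷ 𝟏 ∷ 𝟎 ∷ 𝟎 ∷ []) ∷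
  (𝟎 ∷ 𝟎 ∷ 𝟏 ∷ 𝟎 ∷ []) ∷
  (𝟏 ∷ 𝟎 ∷ 𝟎 ∷ 𝟎 ∷ []) ∷
  (𝟏 ∷ 𝟏 ∷ 𝟏 ∷ 𝟎 ∷ []) ∷ []
T₄ false =
  (𝟎 ∷ 𝟎 ∷ 𝟏 ∷ 𝟏 ∷ []) ∷
  (𝟏 ∷ 𝟎 ∷ 𝟎 ∷ 𝟏 ∷ []) ∷
  (𝟎 ∷ 𝟏 ∷ 𝟎 ∷ 𝟏 ∷ []) ∷
  (𝟎 ∷ 𝟎 ∷ 𝟎 ∷ 𝟎 ∷ []) ∷ []

-- The two rows belong to the elements 0 and 3, and each relation relates at least one of these to
-- itself.
family₄ : List (Vec (Row 4) 2)
family₄ =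
  ((𝟏 ∷ 𝟎 ∷ 𝟎 ∷ 𝟏 ∷ []) ∷ (𝟎 ∷ 𝟎 ∷ 𝟎 ∷ 𝟎 ∷ []) ∷ []) ∷
  ((𝟏 ∷ 𝟏 ∷ 𝟏 ∷ 𝟎 ∷ []) ∷ (𝟎 ∷ 𝟎 ∷ 𝟎 ∷ 𝟎 ∷ []) ∷ []) ∷
  ((𝟎 ∷ 𝟎 ∷ 𝟏 ∷ 𝟏 ∷ []) ∷ (𝟏 ∷ 𝟎 ∷ 𝟎 ∷ 𝟏 ∷ []) ∷ []) ∷
  ((𝟎 ∷ 𝟏 ∷ 𝟎 ∷ 𝟏 ∷ []) ∷ (𝟎 ∷ 𝟎 ∷ 𝟏 ∷ 𝟏 ∷ []) ∷ []) ∷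
  ((𝟏 ∷ 𝟎 ∷ 𝟎 ∷ 𝟎 ∷ []) ∷ (𝟎 ∷ 𝟏 ∷ 𝟎 ∷ 𝟎 ∷ []) ∷ []) ∷ []

full : Fin 1 → Row 4
full _ = 𝟏 ∷ 𝟏 ∷ 𝟏 ∷ 𝟏 ∷ []

module H₄ = Hexagon 4 2 1 1 1 T₄ (λ _ → zero ∷ suc (suc (suc zero)) ∷ []) full full full (λ _ _ → family₄)

certificate₄ : H₄.Certified
certificate₄ = record { isStable = refl ; isLooping = refl }

clique₃ : Universal (Fin 3) (K 3) 4
clique₃ = record { X = Fin 4 ; size = ↔-id _ ; arc = at (T₄ true) ; asym = antisymmetric-at _ refl ; colour = colour }
  where
  colour : ∀ {V N} → Fin N ↔ V → (S : Cover (Fin 3) (K 3) V) → Coloured S (at (T₄ true))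
  colour {V} fin S = x , ok
    where
    open Cover S
    pattern a = zero
    pattern b = suc zero
    pattern c = suc (suc zero)
    sol = H₄.solve certificate₄ fin (mate a b) (mate b a) (mate b c) (mate c b) (mate c a) (mate a c)
      (mate-mate λ ()) (mate-mate λ ()) (mate-mate λ ()) (mate-mate λ ()) (mate-mate λ ()) (mate-mate λ ())
      (λ _ → zero) (λ _ → zero) (λ _ → zero) (out a b) (out b c) (out c a)
    steps = proj₂ (proj₂ (proj₂ sol))
    x : Fin 3 → V → Fin 4
    x a = proj₁ sol
    x b = proj₁ (proj₂ sol)
    x c = proj₁ (proj₂ (proj₂ sol))
    T₄-along : ∀ s {x y} → at (T₄ s) x y ≡ true → along (at (T₄ true)) s x y ≡ true
    T₄-along = at-along T₄ (transposed-at T₄ refl)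
    ab : Respects S (at (T₄ true)) x a b
    ab u = T₄-along (out a b u) (proj₁ (proj₁ steps u))
    bc : Respects S (at (T₄ true)) x b c
    bc u = T₄-along (out b c u) (proj₁ (proj₁ (proj₂ steps) u))
    ca : Respects S (at (T₄ true)) x c a
    ca u = T₄-along (out c a u) (proj₁ (proj₂ (proj₂ steps) u))
    mirror : ∀ {i j} → i ≢ j → Respects S (at (T₄ true)) x i j → Respects S (at (T₄ true)) x j i
    mirror i≢j = respects-sym S (at (T₄ true)) x i≢j (λ e → i≢j (sym e))
    ok : ∀ {i j} → i ≢ j → Respects S (at (T₄ true)) x i j
    ok {a} {a} h = ⊥-elim (h refl)
    ok {a} {b} h = ab
    ok {a} {c} h = mirror (λ ()) ca
    ok {b} {a} h = mirror (λ ()) ab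
    ok {b} {b} h = ⊥-elim (h refl)
    ok {b} {c} h = bc
    ok {c} {a} h = ca
    ok {c} {b} h = mirror (λ ()) bc
    ok {c} {c} h = ⊥-elim (h refl)

-- This tournament and the two poles were found by computer search: class 0 goes to one of the
-- poles, according to its arc to class 1, which leaves class 1 a choice between four elements.
T₈ : Bool → Mat 8
T₈ true =
  (𝟎 ∷ 𝟎 ∷ 𝟎 ∷ 𝟏 ∷ 𝟎 ∷ 𝟏 ∷ 𝟏 ∷ 𝟎 ∷ []) ∷
  (𝟏 ∷ 𝟎 ∷ 𝟎 ∷ 𝟎 ∷ 𝟎 ∷ 𝟎 ∷ 𝟏 ∷ 𝟏 ∷ []) ∷
  (𝟏 ∷ 𝟏 ∷ 𝟎 ∷ 𝟎 ∷ 𝟏 ∷ 𝟎 ∷ 𝟏 ∷ 𝟎 ∷ []) ∷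
  (𝟎 ∷ 𝟏 ∷ 𝟏 ∷ 𝟎 ∷ 𝟏 ∷ 𝟎 ∷ 𝟎 ∷ 𝟎 ∷ []) ∷
  (𝟏 ∷ 𝟏 ∷ 𝟎 ∷ 𝟎 ∷ 𝟎 ∷ 𝟏 ∷ 𝟎 ∷ 𝟎 ∷ []) ∷
  (𝟎 ∷ 𝟏 ∷ 𝟏 ∷ 𝟏 ∷ 𝟎 ∷ 𝟎 ∷ 𝟎 ∷ 𝟏 ∷ []) ∷
  (𝟎 ∷ 𝟎 ∷ 𝟎 ∷ 𝟏 ∷ 𝟏 ∷ 𝟏 ∷ 𝟎 ∷ 𝟏 ∷ []) ∷
  (𝟏 ∷ 𝟎 ∷ 𝟏 ∷ 𝟏 ∷ 𝟏 ∷ 𝟎 ∷ 𝟎 ∷ 𝟎 ∷ []) ∷ []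
T₈ false =
  (𝟎 ∷ 𝟏 ∷ 𝟏 ∷ 𝟎 ∷ 𝟏 ∷ 𝟎 ∷ 𝟎 ∷ 𝟏 ∷ []) ∷
  (𝟎 ∷ 𝟎 ∷ 𝟏 ∷ 𝟏 ∷ 𝟏 ∷ 𝟏 ∷ 𝟎 ∷ 𝟎 ∷ []) ∷
  (𝟎 ∷ 𝟎 ∷ 𝟎 ∷ 𝟏 ∷ 𝟎 ∷ 𝟏 ∷ 𝟎 ∷ 𝟏 ∷ []) ∷
  (𝟏 ∷ 𝟎 ∷ 𝟎 ∷ 𝟎 ∷ 𝟎 ∷ 𝟏 ∷ 𝟏 ∷ 𝟏 ∷ []) ∷
  (𝟎 ∷ 𝟎 ∷ 𝟏 ∷ 𝟏 ∷ 𝟎 ∷ 𝟎 ∷ 𝟏 ∷ 𝟏 ∷ []) ∷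
  (𝟏 ∷ 𝟎 ∷ 𝟎 ∷ 𝟎 ∷ 𝟏 ∷ 𝟎 ∷ 𝟏 ∷ 𝟎 ∷ []) ∷
  (𝟏 ∷ 𝟏 ∷ 𝟏 ∷ 𝟎 ∷ 𝟎 ∷ 𝟎 ∷ 𝟎 ∷ 𝟎 ∷ []) ∷
  (𝟎 ∷ 𝟏 ∷ 𝟎 ∷ 𝟎 ∷ 𝟎 ∷ 𝟏 ∷ 𝟏 ∷ 𝟎 ∷ []) ∷ []

arc₈ : Fin 8 → Fin 8 → Bool
arc₈ = at (T₈ true)

pole : Bool → Fin 8
pole true  = suc (suc (suc (suc (suc (suc (suc zero))))))
pole false = suc (suc (suc (suc zero)))

maskA : Fin 2 → Row 8
maskA zero       = lookup (T₈ true) (pole true)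
maskA (suc zero) = lookup (T₈ false) (pole false)

-- The pole is chosen for the sake of class 1, so for classes 2 and 3 all four combinations of pole
-- and direction occur.
maskB : Fin 4 → Row 8
maskB zero                   = lookup (T₈ true) (pole true)
maskB (suc zero)             = lookup (T₈ false) (pole true)
maskB (suc (suc zero))       = lookup (T₈ true) (pole false)
maskB (suc (suc (suc zero))) = lookup (T₈ false) (pole false)

starts₈ : Fin 2 → Vec (Fin 8) 4
starts₈ zero       = zero ∷ suc (suc zero) ∷ suc (suc (suc zero)) ∷ suc (suc (suc (suc zero))) ∷ []
starts₈ (suc zero) = suc (suc zero) ∷ suc (suc (suc zero)) ∷ suc (suc (suc (suc (suc (suc zero))))) ∷ suc (suc (suc (suc (suc (suc (suc zero)))))) ∷ []

-- The two indices are the masks of class 1 at the start and at the end of a path. Rows run over the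
-- elements of the first mask, and entries outside the second vanish, which leaves 16 bits.
pattern m₀₀ a₁ a₂ a₃ a₄ b₁ b₂ b₃ b₄ c₁ c₂ c₃ c₄ d₁ d₂ d₃ d₄ =
  (a₁ ∷ 𝟎 ∷ a₂ ∷ a₃ ∷ a₄ ∷ 𝟎 ∷ 𝟎 ∷ 𝟎 ∷ []) ∷
  (b₁ ∷ 𝟎 ∷ b₂ ∷ b₃ ∷ b₄ ∷ 𝟎 ∷ 𝟎 ∷ 𝟎 ∷ []) ∷
  (c₁ ∷ 𝟎 ∷ c₂ ∷ c₃ ∷ c₄ ∷ 𝟎 ∷ 𝟎 ∷ 𝟎 ∷ []) ∷
  (d₁ ∷ 𝟎 ∷ d₂ ∷ d₃ ∷ d₄ ∷ 𝟎 ∷ 𝟎 ∷ 𝟎 ∷ []) ∷ []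

pattern m₀₁ a₁ a₂ a₃ a₄ b₁ b₂ b₃ b₄ c₁ c₂ c₃ c₄ d₁ d₂ d₃ d₄ =
  (𝟎 ∷ 𝟎 ∷ a₁ ∷ a₂ ∷ 𝟎 ∷ 𝟎 ∷ a₃ ∷ a₄ ∷ []) ∷
  (𝟎 ∷ 𝟎 ∷ b₁ ∷ b₂ ∷ 𝟎 ∷ 𝟎 ∷ b₃ ∷ b₄ ∷ []) ∷
  (𝟎 ∷ 𝟎 ∷ c₁ ∷ c₂ ∷ 𝟎 ∷ 𝟎 ∷ c₃ ∷ c₄ ∷ []) ∷
  (𝟎 ∷ 𝟎 ∷ d₁ ∷ d₂ ∷ 𝟎 ∷ 𝟎 ∷ d₃ ∷ d₄ ∷ []) ∷ []

pattern m₁₀ a₁ a₂ a₃ a₄ b₁ b₂ b₃ b₄ c₁ c₂ c₃ c₄ d₁ d₂ d₃ d₄ =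
  (a₁ ∷ 𝟎 ∷ a₂ ∷ a₃ ∷ a₄ ∷ 𝟎 ∷ 𝟎 ∷ 𝟎 ∷ []) ∷
  (b₁ ∷ 𝟎 ∷ b₂ ∷ b₃ ∷ b₄ ∷ 𝟎 ∷ 𝟎 ∷ 𝟎 ∷ []) ∷
  (c₁ ∷ 𝟎 ∷ c₂ ∷ c₃ ∷ c₄ ∷ 𝟎 ∷ 𝟎 ∷ 𝟎 ∷ []) ∷
  (d₁ ∷ 𝟎 ∷ d₂ ∷ d₃ ∷ d₄ ∷ 𝟎 ∷ 𝟎 ∷ 𝟎 ∷ []) ∷ []

pattern m₁₁ a₁ a₂ a₃ a₄ b₁ b₂ b₃ b₄ c₁ c₂ c₃ c₄ d₁ d₂ d₃ d₄ =
  (𝟎 ∷ 𝟎 ∷ a₁ ∷ a₂ ∷ 𝟎 ∷ 𝟎 ∷ a₃ ∷ a₄ ∷ []) ∷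
  (𝟎 ∷ 𝟎 ∷ b₁ ∷ b₂ ∷ 𝟎 ∷ 𝟎 ∷ b₃ ∷ b₄ ∷ []) ∷
  (𝟎 ∷ 𝟎 ∷ c₁ ∷ c₂ ∷ 𝟎 ∷ 𝟎 ∷ c₃ ∷ c₄ ∷ []) ∷
  (𝟎 ∷ 𝟎 ∷ d₁ ∷ d₂ ∷ 𝟎 ∷ 𝟎 ∷ d₃ ∷ d₄ ∷ []) ∷ []

family₈ : Fin 2 → Fin 2 → List (Vec (Row 8) 4)
family₈ zero zero =
  m₀₀ 𝟎 𝟏 𝟏 𝟎  𝟎 𝟎 𝟎 𝟎  𝟎 𝟎 𝟏 𝟎  𝟎 𝟎 𝟎 𝟎 ∷
  m₀₀ 𝟏 𝟎 𝟎 𝟎  𝟏 𝟎 𝟏 𝟎  𝟎 𝟎 𝟎 𝟎  𝟎 𝟎 𝟎 𝟎 ∷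
  m₀₀ 𝟎 𝟎 𝟎 𝟎  𝟎 𝟏 𝟎 𝟎  𝟏 𝟏 𝟎 𝟎  𝟎 𝟎 𝟎 𝟎 ∷
  m₀₀ 𝟎 𝟎 𝟏 𝟎  𝟎 𝟏 𝟏 𝟎  𝟎 𝟎 𝟎 𝟎  𝟎 𝟎 𝟎 𝟎 ∷
  m₀₀ 𝟏 𝟎 𝟏 𝟎  𝟎 𝟎 𝟎 𝟎  𝟏 𝟎 𝟎 𝟎  𝟎 𝟎 𝟎 𝟎 ∷
  m₀₀ 𝟎 𝟎 𝟎 𝟎  𝟏 𝟎 𝟎 𝟎  𝟏 𝟎 𝟏 𝟎  𝟎 𝟎 𝟎 𝟎 ∷
  m₀₀ 𝟎 𝟎 𝟎 𝟎  𝟎 𝟎 𝟏 𝟎  𝟎 𝟏 𝟏 𝟎  𝟎 𝟎 𝟎 𝟎 ∷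
  m₀₀ 𝟏 𝟏 𝟎 𝟎  𝟎 𝟎 𝟎 𝟎  𝟎 𝟏 𝟎 𝟎  𝟎 𝟎 𝟎 𝟎 ∷
  m₀₀ 𝟎 𝟏 𝟎 𝟎  𝟏 𝟏 𝟎 𝟎  𝟎 𝟎 𝟎 𝟎  𝟎 𝟎 𝟎 𝟎 ∷
  m₀₀ 𝟏 𝟎 𝟎 𝟎  𝟎 𝟏 𝟏 𝟎  𝟎 𝟎 𝟏 𝟎  𝟎 𝟎 𝟎 𝟎 ∷
  m₀₀ 𝟏 𝟎 𝟏 𝟎  𝟏 𝟎 𝟎 𝟎  𝟎 𝟏 𝟏 𝟎  𝟎 𝟎 𝟎 𝟎 ∷
  m₀₀ 𝟏 𝟎 𝟎 𝟎  𝟎 𝟏 𝟎 𝟎  𝟎 𝟏 𝟏 𝟎  𝟎 𝟎 𝟎 𝟎 ∷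
  m₀₀ 𝟎 𝟎 𝟏 𝟎  𝟏 𝟎 𝟎 𝟎  𝟎 𝟏 𝟏 𝟎  𝟎 𝟎 𝟏 𝟎 ∷
  m₀₀ 𝟏 𝟏 𝟎 𝟎  𝟎 𝟎 𝟏 𝟎  𝟏 𝟎 𝟎 𝟎  𝟎 𝟎 𝟏 𝟎 ∷
  m₀₀ 𝟎 𝟎 𝟎 𝟎  𝟎 𝟎 𝟏 𝟎  𝟏 𝟎 𝟏 𝟏  𝟎 𝟎 𝟎 𝟎 ∷
  m₀₀ 𝟏 𝟎 𝟏 𝟎  𝟏 𝟎 𝟎 𝟎  𝟎 𝟏 𝟎 𝟏  𝟎 𝟎 𝟎 𝟎 ∷
  m₀₀ 𝟎 𝟏 𝟎 𝟎  𝟏 𝟎 𝟏 𝟎  𝟏 𝟏 𝟎 𝟎  𝟎 𝟎 𝟎 𝟏 ∷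
  m₀₀ 𝟏 𝟏 𝟎 𝟎  𝟎 𝟎 𝟏 𝟎  𝟏 𝟎 𝟏 𝟎  𝟎 𝟎 𝟎 𝟎 ∷
  m₀₀ 𝟎 𝟎 𝟏 𝟎  𝟏 𝟎 𝟏 𝟏  𝟎 𝟎 𝟎 𝟎  𝟎 𝟎 𝟎 𝟏 ∷ []
family₈ zero (suc zero) =
  m₀₁ 𝟏 𝟏 𝟎 𝟎  𝟎 𝟎 𝟎 𝟎  𝟎 𝟏 𝟎 𝟎  𝟎 𝟎 𝟎 𝟎 ∷
  m₀₁ 𝟎 𝟎 𝟏 𝟎  𝟎 𝟏 𝟏 𝟎  𝟎 𝟎 𝟎 𝟎  𝟎 𝟎 𝟎 𝟎 ∷
  m₀₁ 𝟎 𝟎 𝟎 𝟎  𝟏 𝟎 𝟎 𝟎  𝟏 𝟎 𝟏 𝟎  𝟎 𝟎 𝟎 𝟎 ∷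
  m₀₁ 𝟎 𝟎 𝟎 𝟎  𝟎 𝟎 𝟏 𝟎  𝟎 𝟏 𝟏 𝟎  𝟎 𝟎 𝟎 𝟎 ∷
  m₀₁ 𝟏 𝟎 𝟎 𝟎  𝟏 𝟎 𝟏 𝟎  𝟎 𝟎 𝟎 𝟎  𝟎 𝟎 𝟎 𝟎 ∷
  m₀₁ 𝟎 𝟏 𝟏 𝟎  𝟎 𝟎 𝟎 𝟎  𝟎 𝟎 𝟏 𝟎  𝟎 𝟎 𝟎 𝟎 ∷
  m₀₁ 𝟏 𝟎 𝟏 𝟎  𝟎 𝟎 𝟎 𝟎  𝟏 𝟎 𝟎 𝟎  𝟎 𝟎 𝟎 𝟎 ∷
  m₀₁ 𝟎 𝟎 𝟎 𝟎  𝟎 𝟏 𝟎 𝟎  𝟏 𝟏 𝟎 𝟎  𝟎 𝟎 𝟎 𝟎 ∷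
  m₀₁ 𝟎 𝟏 𝟎 𝟎  𝟏 𝟏 𝟎 𝟎  𝟎 𝟎 𝟎 𝟎  𝟎 𝟎 𝟎 𝟎 ∷
  m₀₁ 𝟎 𝟏 𝟏 𝟎  𝟎 𝟎 𝟏 𝟎  𝟏 𝟎 𝟎 𝟎  𝟎 𝟎 𝟎 𝟎 ∷
  m₀₁ 𝟎 𝟎 𝟏 𝟎  𝟏 𝟎 𝟎 𝟎  𝟏 𝟏 𝟎 𝟎  𝟎 𝟎 𝟎 𝟎 ∷
  m₀₁ 𝟎 𝟎 𝟏 𝟎  𝟏 𝟏 𝟎 𝟎  𝟎 𝟏 𝟎 𝟎  𝟎 𝟎 𝟎 𝟎 ∷
  m₀₁ 𝟏 𝟎 𝟎 𝟎  𝟎 𝟏 𝟎 𝟎  𝟏 𝟎 𝟏 𝟎  𝟎 𝟎 𝟎 𝟎 ∷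
  m₀₁ 𝟏 𝟎 𝟏 𝟎  𝟏 𝟏 𝟎 𝟎  𝟎 𝟎 𝟏 𝟎  𝟎 𝟏 𝟎 𝟎 ∷
  m₀₁ 𝟎 𝟏 𝟎 𝟎  𝟎 𝟎 𝟏 𝟎  𝟏 𝟏 𝟎 𝟎  𝟎 𝟏 𝟎 𝟎 ∷
  m₀₁ 𝟏 𝟎 𝟏 𝟎  𝟎 𝟎 𝟎 𝟏  𝟎 𝟎 𝟏 𝟏  𝟎 𝟎 𝟎 𝟎 ∷
  m₀₁ 𝟎 𝟏 𝟎 𝟎  𝟏 𝟎 𝟏 𝟏  𝟎 𝟎 𝟎 𝟎  𝟎 𝟎 𝟎 𝟎 ∷
  m₀₁ 𝟎 𝟎 𝟏 𝟎  𝟏 𝟎 𝟎 𝟎  𝟎 𝟏 𝟏 𝟎  𝟎 𝟎 𝟎 𝟎 ∷ []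
family₈ (suc zero) zero =
  m₁₀ 𝟎 𝟏 𝟎 𝟎  𝟎 𝟎 𝟎 𝟎  𝟎 𝟏 𝟏 𝟎  𝟎 𝟎 𝟎 𝟎 ∷
  m₁₀ 𝟏 𝟎 𝟏 𝟎  𝟎 𝟎 𝟏 𝟎  𝟎 𝟎 𝟎 𝟎  𝟎 𝟎 𝟎 𝟎 ∷
  m₁₀ 𝟎 𝟎 𝟎 𝟎  𝟎 𝟏 𝟎 𝟎  𝟏 𝟏 𝟎 𝟎  𝟎 𝟎 𝟎 𝟎 ∷
  m₁₀ 𝟏 𝟏 𝟎 𝟎  𝟏 𝟎 𝟎 𝟎  𝟎 𝟎 𝟎 𝟎  𝟎 𝟎 𝟎 𝟎 ∷
  m₁₀ 𝟎 𝟎 𝟎 𝟎  𝟏 𝟎 𝟎 𝟎  𝟏 𝟎 𝟏 𝟎  𝟎 𝟎 𝟎 𝟎 ∷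
  m₁₀ 𝟏 𝟎 𝟎 𝟎  𝟎 𝟎 𝟎 𝟎  𝟏 𝟏 𝟎 𝟎  𝟎 𝟎 𝟎 𝟎 ∷
  m₁₀ 𝟎 𝟎 𝟎 𝟎  𝟎 𝟎 𝟏 𝟎  𝟎 𝟏 𝟏 𝟎  𝟎 𝟎 𝟎 𝟎 ∷
  m₁₀ 𝟎 𝟏 𝟏 𝟎  𝟎 𝟏 𝟎 𝟎  𝟎 𝟎 𝟎 𝟎  𝟎 𝟎 𝟎 𝟎 ∷
  m₁₀ 𝟎 𝟎 𝟏 𝟎  𝟎 𝟎 𝟎 𝟎  𝟏 𝟎 𝟏 𝟎  𝟎 𝟎 𝟎 𝟎 ∷
  m₁₀ 𝟎 𝟏 𝟏 𝟎  𝟎 𝟎 𝟏 𝟎  𝟏 𝟎 𝟎 𝟎  𝟎 𝟎 𝟎 𝟎 ∷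
  m₁₀ 𝟎 𝟎 𝟏 𝟎  𝟏 𝟎 𝟎 𝟎  𝟏 𝟏 𝟎 𝟎  𝟎 𝟎 𝟎 𝟎 ∷
  m₁₀ 𝟏 𝟎 𝟎 𝟎  𝟏 𝟏 𝟏 𝟎  𝟎 𝟎 𝟏 𝟎  𝟏 𝟏 𝟎 𝟎 ∷
  m₁₀ 𝟎 𝟏 𝟎 𝟏  𝟎 𝟎 𝟏 𝟎  𝟏 𝟎 𝟎 𝟎  𝟎 𝟎 𝟏 𝟎 ∷
  m₁₀ 𝟏 𝟎 𝟎 𝟎  𝟎 𝟏 𝟏 𝟎  𝟏 𝟎 𝟏 𝟎  𝟎 𝟏 𝟎 𝟎 ∷
  m₁₀ 𝟎 𝟏 𝟏 𝟎  𝟏 𝟎 𝟎 𝟎  𝟎 𝟏 𝟎 𝟎  𝟏 𝟏 𝟎 𝟎 ∷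
  m₁₀ 𝟏 𝟎 𝟏 𝟎  𝟎 𝟏 𝟎 𝟎  𝟎 𝟎 𝟏 𝟎  𝟎 𝟏 𝟎 𝟎 ∷
  m₁₀ 𝟏 𝟎 𝟎 𝟏  𝟎 𝟎 𝟎 𝟏  𝟏 𝟎 𝟏 𝟎  𝟎 𝟎 𝟎 𝟎 ∷
  m₁₀ 𝟎 𝟎 𝟏 𝟎  𝟏 𝟎 𝟏 𝟏  𝟎 𝟏 𝟎 𝟎  𝟏 𝟎 𝟎 𝟎 ∷
  m₁₀ 𝟏 𝟎 𝟏 𝟏  𝟎 𝟎 𝟎 𝟎  𝟎 𝟏 𝟏 𝟎  𝟎 𝟎 𝟎 𝟎 ∷
  m₁₀ 𝟎 𝟏 𝟎 𝟎  𝟎 𝟎 𝟏 𝟎  𝟏 𝟎 𝟏 𝟎  𝟎 𝟎 𝟎 𝟎 ∷ []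
family₈ (suc zero) (suc zero) =
  m₁₁ 𝟏 𝟎 𝟎 𝟎  𝟎 𝟎 𝟎 𝟎  𝟏 𝟏 𝟎 𝟎  𝟎 𝟎 𝟎 𝟎 ∷
  m₁₁ 𝟎 𝟏 𝟏 𝟎  𝟎 𝟏 𝟎 𝟎  𝟎 𝟎 𝟎 𝟎  𝟎 𝟎 𝟎 𝟎 ∷
  m₁₁ 𝟎 𝟎 𝟎 𝟎  𝟎 𝟎 𝟏 𝟎  𝟎 𝟏 𝟏 𝟎  𝟎 𝟎 𝟎 𝟎 ∷
  m₁₁ 𝟎 𝟎 𝟎 𝟎  𝟏 𝟎 𝟎 𝟎  𝟏 𝟎 𝟏 𝟎  𝟎 𝟎 𝟎 𝟎 ∷
  m₁₁ 𝟏 𝟎 𝟏 𝟎  𝟎 𝟎 𝟏 𝟎  𝟎 𝟎 𝟎 𝟎  𝟎 𝟎 𝟎 𝟎 ∷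
  m₁₁ 𝟎 𝟎 𝟏 𝟎  𝟎 𝟎 𝟎 𝟎  𝟏 𝟎 𝟏 𝟎  𝟎 𝟎 𝟎 𝟎 ∷
  m₁₁ 𝟏 𝟏 𝟎 𝟎  𝟏 𝟎 𝟎 𝟎  𝟎 𝟎 𝟎 𝟎  𝟎 𝟎 𝟎 𝟎 ∷
  m₁₁ 𝟎 𝟎 𝟎 𝟎  𝟎 𝟏 𝟎 𝟎  𝟏 𝟏 𝟎 𝟎  𝟎 𝟎 𝟎 𝟎 ∷
  m₁₁ 𝟎 𝟏 𝟎 𝟎  𝟎 𝟎 𝟎 𝟎  𝟎 𝟏 𝟏 𝟎  𝟎 𝟎 𝟎 𝟎 ∷
  m₁₁ 𝟏 𝟎 𝟎 𝟎  𝟏 𝟏 𝟎 𝟎  𝟎 𝟎 𝟏 𝟎  𝟎 𝟏 𝟎 𝟎 ∷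
  m₁₁ 𝟏 𝟏 𝟎 𝟎  𝟎 𝟏 𝟎 𝟎  𝟎 𝟎 𝟏 𝟎  𝟎 𝟎 𝟎 𝟎 ∷
  m₁₁ 𝟏 𝟏 𝟎 𝟎  𝟎 𝟎 𝟏 𝟎  𝟏 𝟎 𝟎 𝟎  𝟏 𝟎 𝟏 𝟎 ∷
  m₁₁ 𝟎 𝟎 𝟎 𝟏  𝟎 𝟎 𝟏 𝟎  𝟏 𝟎 𝟏 𝟎  𝟎 𝟎 𝟎 𝟎 ∷
  m₁₁ 𝟎 𝟎 𝟏 𝟎  𝟏 𝟎 𝟎 𝟎  𝟎 𝟏 𝟏 𝟎  𝟏 𝟎 𝟎 𝟎 ∷
  m₁₁ 𝟎 𝟎 𝟏 𝟎  𝟏 𝟏 𝟏 𝟎  𝟎 𝟏 𝟎 𝟎  𝟏 𝟎 𝟏 𝟎 ∷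
  m₁₁ 𝟏 𝟎 𝟏 𝟏  𝟏 𝟎 𝟎 𝟎  𝟎 𝟎 𝟎 𝟎  𝟎 𝟎 𝟎 𝟎 ∷
  m₁₁ 𝟏 𝟏 𝟎 𝟎  𝟎 𝟎 𝟏 𝟎  𝟏 𝟎 𝟏 𝟎  𝟎 𝟎 𝟎 𝟎 ∷
  m₁₁ 𝟎 𝟏 𝟎 𝟎  𝟏 𝟎 𝟏 𝟎  𝟏 𝟎 𝟎 𝟎  𝟎 𝟎 𝟏 𝟏 ∷
  m₁₁ 𝟎 𝟏 𝟏 𝟎  𝟏 𝟎 𝟏 𝟎  𝟎 𝟏 𝟎 𝟎  𝟏 𝟎 𝟎 𝟏 ∷
  m₁₁ 𝟏 𝟎 𝟏 𝟎  𝟏 𝟎 𝟎 𝟎  𝟎 𝟏 𝟏 𝟎  𝟎 𝟎 𝟎 𝟎 ∷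
  m₁₁ 𝟏 𝟎 𝟎 𝟎  𝟎 𝟏 𝟎 𝟎  𝟎 𝟎 𝟏 𝟎  𝟎 𝟏 𝟏 𝟎 ∷ []

module H₈ = Hexagon 8 4 2 4 4 T₈ starts₈ maskA maskB maskB family₈

certificate₈ : H₈.Certified
certificate₈ = record { isStable = refl ; isLooping = refl }

T₈-along : ∀ s {x y} → at (T₈ s) x y ≡ true → along arc₈ s x y ≡ true
T₈-along = at-along T₈ (transposed-at T₈ refl)

listA : Bool → Fin 2
listA true  = zero
listA false = suc zero

listB : Bool → Bool → Fin 4
listB true  true  = zero
listB true  false = suc zero
listB false true  = suc (suc zero)
listB false false = suc (suc (suc zero))

maskA-pole : ∀ s y → lookup (maskA (listA s)) y ≡ true → at (T₈ s) (pole s) y ≡ true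
maskA-pole true  y h = h
maskA-pole false y h = h

maskB-pole : ∀ o s y → lookup (maskB (listB o s)) y ≡ true → at (T₈ s) (pole o) y ≡ true
maskB-pole true  true  y h = h
maskB-pole true  false y h = h
maskB-pole false true  y h = h
maskB-pole false false y h = h

clique₄ : Universal (Fin 4) (K 4) 8
clique₄ = record { X = Fin 8 ; size = ↔-id _ ; arc = arc₈ ; asym = antisymmetric-at arc₈ refl ; colour = colour }
  where
  colour : ∀ {V N} → Fin N ↔ V → (S : Cover (Fin 4) (K 4) V) → Coloured S arc₈
  colour {V} fin S = x , ok
    where
    open Cover S
    pattern z = zero
    pattern a = suc zero
    pattern b = suc (suc zero)
    pattern c = suc (suc (suc zero))
    pick : V → Bool
    pick u = out z a u
    la : V → Fin 2
    la v = listA (pick (mate a z v))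
    lb lc : V → Fin 4
    lb v = listB (pick (mate b z v)) (out z b (mate b z v))
    lc v = listB (pick (mate c z v)) (out z c (mate c z v))
    sol = H₈.solve certificate₈ fin (mate a b) (mate b a) (mate b c) (mate c b) (mate c a) (mate a c)
      (mate-mate λ ()) (mate-mate λ ()) (mate-mate λ ()) (mate-mate λ ()) (mate-mate λ ()) (mate-mate λ ())
      la lb lc (out a b) (out b c) (out c a)
    xa xb xc : V → Fin 8
    xa = proj₁ sol
    xb = proj₁ (proj₂ sol)
    xc = proj₁ (proj₂ (proj₂ sol))
    x : Fin 4 → V → Fin 8
    x z u = pole (pick u)
    x a u = xa u
    x b u = xb u
    x c u = xc u
    steps = proj₂ (proj₂ (proj₂ sol))
    ab : Respects S arc₈ x a b
    ab u = T₈-along (out a b u) (proj₁ (proj₁ steps u))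
    bc : Respects S arc₈ x b c
    bc u = T₈-along (out b c u) (proj₁ (proj₁ (proj₂ steps) u))
    ca : Respects S arc₈ x c a
    ca u = T₈-along (out c a u) (proj₁ (proj₂ (proj₂ steps) u))
    za : Respects S arc₈ x z a
    -- The mask of a vertex is enforced by the step that arrives there, here the one from class 3.
    za u = T₈-along (out z a u) (maskA-pole (out z a u) _
      (subst₂ (λ v s → lookup (maskA (listA s)) (xa v) ≡ true) (mate-mate (λ ()) v) (cong pick (mate-mate (λ ()) u))
        (subst (λ s → lookup (maskA (listA (pick (mate a z s)))) (xa (mate c a (mate a c v))) ≡ true) (mate-mate (λ ()) v)
          (proj₂ (proj₂ (proj₂ steps) (mate a c v))))))
      where v = mate z a u
    zb : Respects S arc₈ x z b
    zb u = T₈-along (out z b u) (maskB-pole (pick u) (out z b u) _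
      (subst₂ (λ v w → lookup (maskB (listB (pick w) (out z b w))) (xb v) ≡ true) (mate-mate (λ ()) v) (mate-mate (λ ()) u)
        (subst (λ s → lookup (maskB (lb s)) (xb (mate a b (mate b a v))) ≡ true) (mate-mate (λ ()) v)
          (proj₂ (proj₁ steps (mate b a v))))))
      where v = mate z b u
    zc : Respects S arc₈ x z c
    zc u = T₈-along (out z c u) (maskB-pole (pick u) (out z c u) _
      (subst₂ (λ v w → lookup (maskB (listB (pick w) (out z c w))) (xc v) ≡ true) (mate-mate (λ ()) v) (mate-mate (λ ()) u)
        (subst (λ s → lookup (maskB (lc s)) (xc (mate b c (mate c b v))) ≡ true) (mate-mate (λ ()) v)
          (proj₂ (proj₁ (proj₂ steps) (mate c b v))))))
      where v = mate z c u
    mirror : ∀ {i j} → i ≢ j → Respects S arc₈ x i j → Respects S arc₈ x j i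
    mirror i≢j = respects-sym S arc₈ x i≢j (λ e → i≢j (sym e))
    ok : ∀ {i j} → i ≢ j → Respects S arc₈ x i j
    ok {z} {z} h = ⊥-elim (h refl)
    ok {z} {a} h = za
    ok {z} {b} h = zb
    ok {z} {c} h = zc
    ok {a} {z} h = mirror (λ ()) za
    ok {a} {a} h = ⊥-elim (h refl)
    ok {a} {b} h = ab
    ok {a} {c} h = mirror (λ ()) ca
    ok {b} {z} h = mirror (λ ()) zb
    ok {b} {a} h = mirror (λ ()) ab
    ok {b} {b} h = ⊥-elim (h refl)
    ok {b} {c} h = bc
    ok {c} {z} h = mirror (λ ()) zc
    ok {c} {a} h = ca
    ok {c} {b} h = mirror (λ ()) bc
    ok {c} {c} h = ⊥-elim (h refl)

-- For six classes 0, 1, 2, a, b, c. An element early i x e of class i ≤ 2 stores in x its arc to the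
-- next of these classes, and e is xored to its relation with all the other elements. An element of
-- Y₆ has a cell in F₂³, its relation to the classes 0, 1, 2. Class 0 chooses e so that coordinate 0
-- of its neighbour in b vanishes, classes 1 and 2 so that coordinates 1 and 2 of their neighbours in
-- c vanish. Hence b lives in the cells 0**, on the elements side, and c in *00, on the elements
-- centre; in the common cell b uses the elements of c. Class a has one element f per cell, except
-- in cell 100, where it uses the elements of c.
Y₆ X₆ : Set
Y₆ = Bits 2 ⊎ (Fin 3 ⊎ (Bits 3 ⊎ (Fin 3 × Bool)))
X₆ = (Fin 3 × Bits 2) ⊎ Y₆

pattern early i x e  = inj₁ (i , x , e , tt)
pattern f₀ y z       = inj₁ (y , z , tt)
pattern f₁ β         = inj₂ (inj₁ β)
pattern centre γ σ w = inj₂ (inj₂ (inj₁ (γ , σ , w , tt)))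
pattern side β σ     = inj₂ (inj₂ (inj₂ (β , σ)))

X₆-size : Fin 33 ↔ X₆
X₆-size = ((↔-id _ ×-↔ bits-size 2) ↔-∘ *↔×) ⊕ (bits-size 2 ⊕ (↔-id (Fin 3) ⊕ (bits-size 3 ⊕ ((↔-id _ ×-↔ 2↔Bool) ↔-∘ *↔×))))
  where
  _⊕_ : ∀ {a b} {A B : Set} → Fin a ↔ A → Fin b ↔ B → Fin (a + b) ↔ (A ⊎ B)
  p ⊕ q = (p ⊎-↔ q) ↔-∘ +↔⊎

first second : Fin 3 → Bool
first zero    = false
first (suc _) = true
second (suc zero) = false
second _          = true

cell : Y₆ → Fin 3 → Bool
cell (f₀ y z) zero = false
cell (f₀ y z) (suc zero) = y
cell (f₀ y z) (suc (suc zero)) = z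
cell (f₁ β) zero = true
cell (f₁ β) (suc zero) = first β
cell (f₁ β) (suc (suc zero)) = second β
cell (centre γ σ w) zero = γ
cell (centre γ σ w) (suc _) = false
cell (side β σ) zero = false
cell (side β σ) (suc zero) = first β
cell (side β σ) (suc (suc zero)) = second β

-- A linear order on the pairs `(σ , w)`: `(true , false)`, `(false , false)`, `(false , true)`,
-- `(true , true)`.
before : Bool → Bool → Bool → Bool → Bool
before true  false true  false = false
before true  false _     _     = true
before false false false true  = true
before false false true  true  = true
before false true  true  true  = true
before _     _     _     _     = false

-- The labels are stored arcs: `σ` is the arc arriving from the elements f, and `w` the one arriving
-- from the elements side.
hexArc : Y₆ → Y₆ → Bool
hexArc (f₀ _ _) (centre _ σ _) = σ
hexArc (f₁ _)   (centre _ σ _) = σ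
hexArc (centre _ σ _) (f₀ _ _) = not σ
hexArc (centre _ σ _) (f₁ _)   = not σ
hexArc (f₀ _ _) (side _ σ) = σ
hexArc (f₁ _)   (side _ σ) = σ
hexArc (side _ σ) (f₀ _ _) = not σ
hexArc (side _ σ) (f₁ _)   = not σ
hexArc (side _ _)     (centre _ _ w) = w
hexArc (centre _ _ w) (side _ _)     = not w
hexArc (centre false σ w) (centre true σ′ w′) = (σ xor w) xor w′
hexArc (centre true σ′ w′) (centre false σ w) = not ((σ xor w) xor w′)
hexArc (centre true σ _) (centre true σ′ _) = not σ ∧ σ′
hexArc (centre false σ w) (centre false σ′ w′) = before σ w σ′ w′
hexArc _ _ = false

earlyArc : Fin 3 → Bool → Fin 3 → Bool → Bool
earlyArc zero             x (suc zero)       _ = x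
earlyArc (suc zero)       x (suc (suc zero)) _ = x
earlyArc (suc (suc zero)) x zero             _ = x
earlyArc (suc zero)       _ zero             y = not y
earlyArc (suc (suc zero)) _ (suc zero)       y = not y
earlyArc zero             _ (suc (suc zero)) y = not y
earlyArc _                _ _                _ = false

arc₆ : X₆ → X₆ → Bool
arc₆ (early i x _) (early j y _) = earlyArc i x j y
arc₆ (early i _ e) (inj₂ h)      = cell h i xor e
arc₆ (inj₂ h)      (early i _ e) = not (cell h i xor e)
arc₆ (inj₂ h)      (inj₂ h′)     = hexArc h h′

arc₆-asym : ∀ x y → arc₆ x y ≡ true → ¬ arc₆ y x ≡ true
arc₆-asym x y = subst₂ (λ x y → arc₆ x y ≡ true → ¬ arc₆ y x ≡ true) (strictlyInverseˡ x) (strictlyInverseˡ y)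
  (antisymmetric-at (λ i j → arc₆ (to i) (to j)) refl (from x) (from y))
  where open Inverse X₆-size

anchor : Bool → Bool → Bool → Bool → Bool → Y₆
anchor false y     z     _ _ = f₀ y z
-- The label `not s` suits every side element in class b, and `not t` leaves class c, when in this
-- same cell, the two elements with `σ` equal to `t`.
anchor true  false false s t = centre true (not t) (not s)
anchor true  false true  _ _ = f₁ zero
anchor true  true  false _ _ = f₁ (suc zero)
anchor true  true  true  _ _ = f₁ (suc (suc zero))

sides : Bool → Bool → List Y₆
sides false false = centre false false false ∷ centre false false true ∷ centre false true false ∷ centre false true true ∷ []
sides false true  = side zero false ∷ side zero true ∷ []
sides true  false = side (suc zero) false ∷ side (suc zero) true ∷ []
sides true  true  = side (suc (suc zero)) false ∷ side (suc (suc zero)) true ∷ []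

centres : Bool → List Y₆
centres γ = centre γ false false ∷ centre γ false true ∷ centre γ true false ∷ centre γ true true ∷ []

search : {A : Set} → (A → Bool) → List A → A → A
search P []       d = d
search P (x ∷ xs) d with P x
... | true  = x
... | false = search P xs d

search₂ : {A : Set} → (A → A → Bool) → List A → List A → A × A → A × A
search₂ P []       ys d = d
search₂ P (x ∷ xs) ys d with someIn (P x) ys
... | true  = x , search (P x) ys (proj₂ d)
... | false = search₂ P xs ys d

-- Class a is settled beforehand by `anchor`, so each matched pair in b and c can be chosen on its
-- own. Its 14 bits are: cell and two arcs for the mate in a of either end (5 + 5), the free cell
-- coordinates of b and c (2 + 1), and the arc between b and c.
View : Set
View = Bits 14

-- A fallback for the searches; `all-good` shows that what they return is right for all views.
default : Y₆
default = centre false false false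

pick : View → Y₆ × Y₆
pick (z₀ , z₁ , z₂ , s , t , y₁ , y₂ , z₀′ , z₁′ , z₂′ , s′ , t′ , γ , p , tt) =
  search₂ (λ b c → along hexArc s (anchor z₀ z₁ z₂ s t) b ∧ (along hexArc t′ (anchor z₀′ z₁′ z₂′ s′ t′) c ∧ along hexArc p b c))
    (sides y₁ y₂) (centres γ) (default , default)

inCell : Y₆ → Bool → Bool → Bool → Bool
inCell x z₀ z₁ z₂ = (cell x zero ⇔ᵇ z₀) ∧ ((cell x (suc zero) ⇔ᵇ z₁) ∧ (cell x (suc (suc zero)) ⇔ᵇ z₂))

good : View → Bool
good v@(z₀ , z₁ , z₂ , s , t , y₁ , y₂ , z₀′ , z₁′ , z₂′ , s′ , t′ , γ , p , tt) = check (pick v)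
  where
  check : Y₆ × Y₆ → Bool
  check (b , c) = (along hexArc s (anchor z₀ z₁ z₂ s t) b ∧ (along hexArc t′ (anchor z₀′ z₁′ z₂′ s′ t′) c ∧ along hexArc p b c))
    ∧ (inCell b false y₁ y₂ ∧ inCell c γ false false)

all-good : everyBits good ≡ true
all-good = refl

anchor-cell : ∀ z₀ z₁ z₂ s t → inCell (anchor z₀ z₁ z₂ s t) z₀ z₁ z₂ ≡ true
anchor-cell z₀ z₁ z₂ s t =
  everyBits-at (λ (z₀ , z₁ , z₂ , s , t , tt) → inCell (anchor z₀ z₁ z₂ s t) z₀ z₁ z₂) refl (z₀ , z₁ , z₂ , s , t , tt)

along-hex : ∀ s h h′ → along arc₆ s (inj₂ h) (inj₂ h′) ≡ along hexArc s h h′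
along-hex true  h h′ = refl
along-hex false h h′ = refl

along-early : ∀ s i x e h → cell h i ≡ s xor e → along arc₆ s (early i x e) (inj₂ h) ≡ true
along-early true  i x e h eq rewrite eq = xor-cancel true e
along-early false i x e h eq rewrite eq = cong not (xor-same e)

inCell-at : ∀ h z₀ z₁ z₂ → inCell h z₀ z₁ z₂ ≡ true →
            cell h zero ≡ z₀ × cell h (suc zero) ≡ z₁ × cell h (suc (suc zero)) ≡ z₂
inCell-at h z₀ z₁ z₂ q with ∧-split q
... | q₀ , q′ with ∧-split q′
...   | q₁ , q₂ = ⇔ᵇ-≡ q₀ , ⇔ᵇ-≡ q₁ , ⇔ᵇ-≡ q₂

clique₆ : Universal (Fin 6) (K 6) 33
clique₆ = record { X = X₆ ; size = X₆-size ; arc = arc₆ ; asym = arc₆-asym ; colour = λ _ → colour }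
  where
  colour : ∀ {V} (S : Cover (Fin 6) (K 6) V) → Coloured S arc₆
  colour {V} S = x , ok
    where
    open Cover S
    pattern #0 = zero
    pattern #1 = suc zero
    pattern #2 = suc (suc zero)
    pattern a = suc (suc (suc zero))
    pattern b = suc (suc (suc (suc zero)))
    pattern c = suc (suc (suc (suc (suc zero))))
    e₀ e₁ e₂ : V → Bool
    e₀ u = out #0 b u
    e₁ u = out #1 c u
    e₂ u = out #2 c u
    -- The cell coordinates that a vertex of class `t` must have for its arcs to classes 0, 1 and 2
    -- to come out right.
    z₀ z₁ z₂ : Fin 6 → V → Bool
    z₀ t v = out #0 t (mate t #0 v) xor e₀ (mate t #0 v)
    z₁ t v = out #1 t (mate t #1 v) xor e₁ (mate t #1 v)
    z₂ t v = out #2 t (mate t #2 v) xor e₂ (mate t #2 v)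
    anchorAt : V → Y₆
    anchorAt u = anchor (z₀ a u) (z₁ a u) (z₂ a u) (out a b u) (out a c u)
    view : V → V → V → V → View
    view u v w u′ = z₀ a u , z₁ a u , z₂ a u , out a b u , out a c u , z₁ b v , z₂ b v ,
      z₀ a u′ , z₁ a u′ , z₂ a u′ , out a b u′ , out a c u′ , z₀ c w , out b c v , tt
    pickAt : V → Y₆ × Y₆
    pickAt v = pick (view (mate b a v) v (mate b c v) (mate c a (mate b c v)))
    x : Fin 6 → V → X₆
    x #0 u = early zero (out #0 #1 u) (e₀ u)
    x #1 u = early (suc zero) (out #1 #2 u) (e₁ u)
    x #2 u = early (suc (suc zero)) (out #2 #0 u) (e₂ u)
    x a u = inj₂ (anchorAt u)
    x b v = inj₂ (proj₁ (pickAt v))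
    -- Pairs are computed at their end in class b; the end in class c looks its value up there.
    x c w = inj₂ (proj₂ (pickAt (mate c b w)))
    Good : V → V → V → V → Y₆ × Y₆ → Set
    Good u v w u′ (y , y′) =
      along hexArc (out a b u) (anchorAt u) y ≡ true × along hexArc (out a c u′) (anchorAt u′) y′ ≡ true ×
      along hexArc (out b c v) y y′ ≡ true × inCell y false (z₁ b v) (z₂ b v) ≡ true × inCell y′ (z₀ c w) false false ≡ true
    goodAt : ∀ v → Good (mate b a v) v (mate b c v) (mate c a (mate b c v)) (pickAt v)
    goodAt v with ∧-split (everyBits-at good all-good (view (mate b a v) v (mate b c v) (mate c a (mate b c v))))
    ... | p , q with ∧-split p | ∧-split q
    ...   | p₁ , p₂ | q₁ , q₂ with ∧-split p₂
    ...     | p₃ , p₄ = p₁ , p₃ , p₄ , q₁ , q₂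
    ab : Respects S arc₆ x a b
    ab u = trans (along-hex (out a b u) _ _)
      (subst (λ w → along hexArc (out a b w) (anchorAt w) (proj₁ (pickAt (mate a b u))) ≡ true) (mate-mate (λ ()) u) (proj₁ (goodAt (mate a b u))))
    bc : Respects S arc₆ x b c
    bc v = trans (along-hex (out b c v) _ _)
      (subst (λ w → along hexArc (out b c v) (proj₁ (pickAt v)) (proj₂ (pickAt w)) ≡ true) (sym (mate-mate (λ ()) v))
        (proj₁ (proj₂ (proj₂ (goodAt v)))))
    ac : Respects S arc₆ x a c
    ac u = trans (along-hex (out a c u) _ _)
      (subst (λ w → along hexArc (out a c w) (anchorAt w) (proj₂ (pickAt v)) ≡ true)
        (trans (cong (mate c a) (mate-mate (λ ()) (mate a c u))) (mate-mate (λ ()) u)) (proj₁ (proj₂ (goodAt v))))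
      where v = mate c b (mate a c u)
    cellA : ∀ u → _
    cellA u = inCell-at (anchorAt u) (z₀ a u) (z₁ a u) (z₂ a u) (anchor-cell (z₀ a u) (z₁ a u) (z₂ a u) (out a b u) (out a c u))
    cellB : ∀ v → _
    cellB v = inCell-at (proj₁ (pickAt v)) false (z₁ b v) (z₂ b v) (proj₁ (proj₂ (proj₂ (proj₂ (goodAt v)))))
    cellC : ∀ w → cell (proj₂ (pickAt (mate c b w))) zero ≡ z₀ c w ×
                  cell (proj₂ (pickAt (mate c b w))) (suc zero) ≡ false × cell (proj₂ (pickAt (mate c b w))) (suc (suc zero)) ≡ false
    cellC w = inCell-at (proj₂ (pickAt (mate c b w))) (z₀ c w) false false
      (subst (λ w′ → inCell (proj₂ (pickAt (mate c b w))) (z₀ c w′) false false ≡ true) (mate-mate (λ ()) w)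
        (proj₂ (proj₂ (proj₂ (proj₂ (goodAt (mate c b w)))))))
    r0a : Respects S arc₆ x #0 a
    r0a u = along-early (out #0 a u) zero _ (e₀ u) _
      (trans (proj₁ (cellA (mate #0 a u))) (cong (λ w → out #0 a w xor e₀ w) (mate-mate (λ ()) u)))
    r1a : Respects S arc₆ x #1 a
    r1a u = along-early (out #1 a u) (suc zero) _ (e₁ u) _
      (trans (proj₁ (proj₂ (cellA (mate #1 a u)))) (cong (λ w → out #1 a w xor e₁ w) (mate-mate (λ ()) u)))
    r2a : Respects S arc₆ x #2 a
    r2a u = along-early (out #2 a u) (suc (suc zero)) _ (e₂ u) _
      (trans (proj₂ (proj₂ (cellA (mate #2 a u)))) (cong (λ w → out #2 a w xor e₂ w) (mate-mate (λ ()) u)))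
    r0b : Respects S arc₆ x #0 b
    r0b u = along-early (out #0 b u) zero _ (e₀ u) _
      (trans (proj₁ (cellB (mate #0 b u))) (sym (xor-same (out #0 b u))))
    r1b : Respects S arc₆ x #1 b
    r1b u = along-early (out #1 b u) (suc zero) _ (e₁ u) _
      (trans (proj₁ (proj₂ (cellB (mate #1 b u)))) (cong (λ w → out #1 b w xor e₁ w) (mate-mate (λ ()) u)))
    r2b : Respects S arc₆ x #2 b
    r2b u = along-early (out #2 b u) (suc (suc zero)) _ (e₂ u) _
      (trans (proj₂ (proj₂ (cellB (mate #2 b u)))) (cong (λ w → out #2 b w xor e₂ w) (mate-mate (λ ()) u)))
    r0c : Respects S arc₆ x #0 c
    r0c u = along-early (out #0 c u) zero _ (e₀ u) _
      (trans (proj₁ (cellC (mate #0 c u))) (cong (λ w → out #0 c w xor e₀ w) (mate-mate (λ ()) u)))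
    r1c : Respects S arc₆ x #1 c
    r1c u = along-early (out #1 c u) (suc zero) _ (e₁ u) _
      (trans (proj₁ (proj₂ (cellC (mate #1 c u)))) (sym (xor-same (out #1 c u))))
    r2c : Respects S arc₆ x #2 c
    r2c u = along-early (out #2 c u) (suc (suc zero)) _ (e₂ u) _
      (trans (proj₂ (proj₂ (cellC (mate #2 c u)))) (sym (xor-same (out #2 c u))))
    r01 : Respects S arc₆ x #0 #1
    r01 u with out #0 #1 u
    ... | true  = refl
    ... | false = refl
    r12 : Respects S arc₆ x #1 #2
    r12 u with out #1 #2 u
    ... | true  = refl
    ... | false = refl
    r20 : Respects S arc₆ x #2 #0
    r20 u with out #2 #0 u
    ... | true  = refl
    ... | false = refl
    mirror : ∀ {i j} → i ≢ j → Respects S arc₆ x i j → Respects S arc₆ x j i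
    mirror i≢j = respects-sym S arc₆ x i≢j (λ e → i≢j (sym e))
    ok : ∀ {i j} → i ≢ j → Respects S arc₆ x i j
    ok {#0} {#0} h = ⊥-elim (h refl)
    ok {#0} {#1} h = r01
    ok {#0} {#2} h = mirror (λ ()) r20
    ok {#0} {a} h = r0a
    ok {#0} {b} h = r0b
    ok {#0} {c} h = r0c
    ok {#1} {#0} h = mirror (λ ()) r01
    ok {#1} {#1} h = ⊥-elim (h refl)
    ok {#1} {#2} h = r12
    ok {#1} {a} h = r1a
    ok {#1} {b} h = r1b
    ok {#1} {c} h = r1c
    ok {#2} {#0} h = r20
    ok {#2} {#1} h = mirror (λ ()) r12
    ok {#2} {#2} h = ⊥-elim (h refl)
    ok {#2} {a} h = r2a
    ok {#2} {b} h = r2b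
    ok {#2} {c} h = r2c
    ok {a} {#0} h = mirror (λ ()) r0a
    ok {a} {#1} h = mirror (λ ()) r1a
    ok {a} {#2} h = mirror (λ ()) r2a
    ok {a} {a} h = ⊥-elim (h refl)
    ok {a} {b} h = ab
    ok {a} {c} h = ac
    ok {b} {#0} h = mirror (λ ()) r0b
    ok {b} {#1} h = mirror (λ ()) r1b
    ok {b} {#2} h = mirror (λ ()) r2b
    ok {b} {a} h = mirror (λ ()) ab
    ok {b} {b} h = ⊥-elim (h refl)
    ok {b} {c} h = bc
    ok {c} {#0} h = mirror (λ ()) r0c
    ok {c} {#1} h = mirror (λ ()) r1c
    ok {c} {#2} h = mirror (λ ()) r2c
    ok {c} {a} h = mirror (λ ()) ac
    ok {c} {b} h = mirror (λ ()) bc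
    ok {c} {c} h = ⊥-elim (h refl)

-- Class i records the classes i + s for the squares s = 1, 2, 4 modulo 7; as -1 is not a square, of
-- any two classes exactly one records the other.
clique₇ : Universal (Fin 7) (K 7) 56
clique₇ = Recording.universal (↔-id _) rec target
  (λ {i} {j} h → from h (from-yes (all? λ i → all? λ j → i ≟ j ⊎-dec (one? i j ⊎-dec one? j i)) i j))
  where
  offset : ℕ → Maybe (Fin 3)
  offset 1 = just zero
  offset 2 = just (suc zero)
  offset 4 = just (suc (suc zero))
  offset _ = nothing
  rec : Fin 7 → Fin 7 → Maybe (Fin 3)
  rec i j = offset ((7 + toℕ j ∸ toℕ i) % 7)
  shift : Fin 7 → Fin 7
  shift (suc (suc (suc (suc (suc (suc zero)))))) = zero
  shift zero = suc zero
  shift (suc zero) = suc (suc zero)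
  shift (suc (suc zero)) = suc (suc (suc zero))
  shift (suc (suc (suc zero))) = suc (suc (suc (suc zero)))
  shift (suc (suc (suc (suc zero)))) = suc (suc (suc (suc (suc zero))))
  shift (suc (suc (suc (suc (suc zero))))) = suc (suc (suc (suc (suc (suc zero)))))
  target : Fin 7 → Fin 3 → Fin 7
  target i zero             = shift i
  target i (suc zero)       = shift (shift i)
  target i (suc (suc zero)) = shift (shift (shift (shift i)))
  One : Fin 7 → Fin 7 → Set
  One i j = ∃ λ t → rec i j ≡ just t × target i t ≡ j × rec j i ≡ nothing
  one? : ∀ i j → Dec (One i j)
  one? i j = any? λ t → Maybe.≡-dec _≟_ (rec i j) (just t) ×-dec (target i t ≟ j ×-dec Maybe.≡-dec _≟_ (rec j i) nothing)
  from : ∀ {i j} → i ≢ j → i ≡ j ⊎ (One i j ⊎ One j i) → One i j ⊎ One j i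
  from h (inj₁ e) = ⊥-elim (h e)
  from h (inj₂ o) = o

-- From products of graphs to covers

-- A default direction for the arcs at dummy vertices: adjacent classes always differ in their rows.
less : ∀ {k} → Fin k → Fin k → Bool
less zero    zero    = false
less zero    (suc j) = true
less (suc i) zero    = false
less (suc i) (suc j) = less i j

less-swap : ∀ {k} (i j : Fin k) → i ≢ j → less j i ≡ not (less i j)
less-swap zero    zero    h = ⊥-elim (h refl)
less-swap zero    (suc j) h = refl
less-swap (suc i) zero    h = refl
less-swap (suc i) (suc j) h = less-swap i j (λ e → h (cong suc e))

module _ (G : Graph) {k} (f : Fin (Graph.n G) → Fin k) (ok : ∀ u v → SqAdj G u v → ¬ (f u ≡ f v)) where

  edge-sym : ∀ {u v} → T (Graph.adj G u v) → T (Graph.adj G v u)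
  edge-sym {u} {v} = subst T (Graph.sym G u v)

  edge-≢ : ∀ {u v} → T (Graph.adj G u v) → u ≢ v
  edge-≢ {u} h refl = subst T (Graph.irref G u) h

  edge-colour : ∀ {u v} → T (Graph.adj G u v) → f u ≢ f v
  edge-colour {u} {v} h = ok u v (edge-≢ h , inj₁ h)

  -- Distinct neighbours of `u` are adjacent in the square, so their colours differ.
  neighbour-unique : ∀ {u v w} → T (Graph.adj G u v) → T (Graph.adj G u w) → f v ≡ f w → v ≡ w
  neighbour-unique {u} {v} {w} uv uw e with v ≟ w
  ... | yes p = p
  ... | no ¬p = ⊥-elim (ok v w (¬p , inj₂ (u , edge-sym uv , uw)) e)

module _ (G H : Graph) {k ℓ : ℕ} (f : Fin (Graph.n G) → Fin k) (f-ok : ∀ u v → SqAdj G u v → ¬ (f u ≡ f v))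
         (g : Fin (Graph.n H) → Fin ℓ) (g-ok : ∀ u v → SqAdj H u v → ¬ (g u ≡ g v)) where

  V C : Set
  V = ProdV G H
  C = Fin k × Fin ℓ

  E : V → V → Set
  E = ProdAdj G H

  col : V → C
  col (u , v) = f u , g v

  E-sym : ∀ {v w} → E v w → E w v
  E-sym {u , v} {u′ , v′} e with Equivalence.to (T-∧ {Graph.adj G u u′}) e
  ... | p , q = Equivalence.from T-∧ (edge-sym G f f-ok p , edge-sym H g g-ok q)

  E-col : ∀ {v w} → E v w → K× k ℓ (col v) (col w)
  E-col {u , v} {u′ , v′} e with Equivalence.to (T-∧ {Graph.adj G u u′}) e
  ... | p , q = edge-colour G f f-ok p , edge-colour H g g-ok q

  E-unique : ∀ {v w w′} → E v w → E v w′ → col w ≡ col w′ → w ≡ w′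
  E-unique {u , v} {w₁ , w₂} {w₁′ , w₂′} e e′ c
    with Equivalence.to (T-∧ {Graph.adj G u w₁}) e | Equivalence.to (T-∧ {Graph.adj G u w₁′}) e′
  ... | p , q | p′ , q′ = cong₂ _,_ (neighbour-unique G f f-ok p p′ (cong proj₁ c)) (neighbour-unique H g g-ok q q′ (cong proj₂ c))

  -- Separates the arcs of the cover that come from edges of the product from those that have to be
  -- invented.
  Real : C → C → V → Set
  Real c d v = col v ≡ c × ∃ λ w → E v w × col w ≡ d

  real? : ∀ c d v → Dec (Real c d v)
  real? c d v = ≡-dec _≟_ _≟_ (col v) c ×-dec
    map′ (λ (a , b , h) → (a , b) , h) (λ ((a , b) , h) → a , b , h)
      (any? λ a → any? λ b → T? (Graph.adj G (proj₁ v) a ∧ Graph.adj H (proj₂ v) b) ×-dec ≡-dec _≟_ _≟_ (col (a , b)) d)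

  -- Copies (c , v) of a vertex v whose colour is not c are added to make every class meet
  -- every adjacent class in a perfect matching: partners are swapped, other vertices are fixed.
  mate : C → C → V → V
  mate c d v with real? c d v
  ... | yes (_ , w , _) = w
  ... | no _ with real? d c v
  ...   | yes (_ , w , _) = w
  ...   | no _ = v

  mate-real : ∀ {c d v w} → col v ≡ c → E v w → col w ≡ d → mate c d v ≡ w
  mate-real {c} {d} {v} {w} cv e cw with real? c d v
  ... | yes (_ , w′ , e′ , cw′) = E-unique e′ e (trans cw′ (sym cw))
  ... | no h = ⊥-elim (h (cv , w , e , cw))

  -- The copy `(d , v)` is already matched with `(c , w)` through the edge, so the dummy `(c , v)`
  -- is matched with the dummy `(d , w)`.
  mate-mirror : ∀ {c d v w} → c ≢ d → col v ≡ d → E v w → col w ≡ c → mate c d v ≡ w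
  mate-mirror {c} {d} {v} {w} c≢d cv e cw with real? c d v
  ... | yes (cv′ , _) = ⊥-elim (c≢d (trans (sym cv′) cv))
  ... | no _ with real? d c v
  ...   | yes (_ , w′ , e′ , cw′) = E-unique e′ e (trans cw′ (sym cw))
  ...   | no h = ⊥-elim (h (cv , w , e , cw))

  mate-none : ∀ {c d v} → ¬ Real c d v → ¬ Real d c v → mate c d v ≡ v
  mate-none {c} {d} {v} h h′ with real? c d v
  ... | yes r = ⊥-elim (h r)
  ... | no _ with real? d c v
  ...   | yes r = ⊥-elim (h′ r)
  ...   | no _ = refl

  mate-mate : ∀ {c d} → c ≢ d → ∀ v → mate d c (mate c d v) ≡ v
  mate-mate {c} {d} c≢d v with real? c d v
  ... | yes (cv , w , e , cw) = mate-real cw (E-sym e) cv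
  ... | no h with real? d c v
  ...   | yes (cv , w , e , cw) = mate-mirror (λ p → c≢d (sym p)) cw (E-sym e) cv
  ...   | no h′ = mate-none h′ h

  module _ (O : Orientation V E) where
    open Orientation O

    out : C → C → V → Bool
    out c d v with real? c d v
    ... | no _ = less (proj₁ c) (proj₁ d)
    ... | yes (_ , w , e , _) with edgeArc v w e
    ...   | inj₁ _ = true
    ...   | inj₂ _ = false

    out-true : ∀ {c d v w} → col v ≡ c → col w ≡ d → Arc v w → out c d v ≡ true
    out-true {c} {d} {v} {w} cv cw a with real? c d v
    ... | no h = ⊥-elim (h (cv , w , arcEdge v w a , cw))
    ... | yes (_ , w′ , e , cw′) with edgeArc v w′ e
    ...   | inj₁ _ = refl
    ...   | inj₂ a′ with E-unique e (arcEdge v w a) (trans cw′ (sym cw))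
    ...     | refl = ⊥-elim (noOpp v w a a′)

    out-false : ∀ {c d v w} → col v ≡ c → col w ≡ d → Arc w v → out c d v ≡ false
    out-false {c} {d} {v} {w} cv cw a with real? c d v
    ... | no h = ⊥-elim (h (cv , w , E-sym (arcEdge w v a) , cw))
    ... | yes (_ , w′ , e , cw′) with edgeArc v w′ e
    ...   | inj₂ _ = refl
    ...   | inj₁ a′ with E-unique e (E-sym (arcEdge w v a)) (trans cw′ (sym cw))
    ...     | refl = ⊥-elim (noOpp w v a a′)

    out-virtual : ∀ {c d v} → ¬ Real c d v → out c d v ≡ less (proj₁ c) (proj₁ d)
    out-virtual {c} {d} {v} h with real? c d v
    ... | no _ = refl
    ... | yes r = ⊥-elim (h r)

    out-mate : ∀ {c d} → K× k ℓ c d → ∀ v → out d c (mate c d v) ≡ not (out c d v)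
    out-mate {c} {d} (p , q) v with real? c d v
    ... | yes (cv , w , e , cw) with edgeArc v w e
    ...   | inj₁ a = out-false cw cv a
    ...   | inj₂ a = out-true cw cv a
    out-mate {c} {d} (p , q) v | no h with real? d c v
    ... | yes (cv , w , e , cw) =
      -- The mate `w` has colour `c`, so its copy in class `d` is a dummy too.
      trans (out-virtual (λ (cw′ , _) → p (cong proj₁ (trans (sym cw) cw′)))) (less-swap (proj₁ c) (proj₁ d) p)
    ... | no h′ = trans (out-virtual h′) (less-swap (proj₁ c) (proj₁ d) p)

    cover : Cover C (K× k ℓ) V
    cover = record { mate = mate ; mate-mate = λ (p , q) → mate-mate (λ e → p (cong proj₁ e)) ; out = out ; out-mate = out-mate }

  -- Every vertex is read off in the class of its own colour, where the cover reproduces the given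
  -- orientation.
  homs : ∀ {m} → Universal C (K× k ℓ) m → Σ (OrientedGraph m) λ T′ → (O : Orientation V E) → Hom O T′
  homs {m} U = T′ , hom
    where
    open Universal U
    open Inverse size
    T′ : OrientedGraph m
    T′ = record
      { Arc = λ i j → arc (to i) (to j) ≡ true
      ; noLoop = λ i h → asym (to i) (to i) h h
      ; noOpp = λ i j → asym (to i) (to j) }
    hom : (O : Orientation V E) → Hom O T′
    hom O = (λ v → from (x (col v) v)) , λ v w a →
      subst₂ (λ s t → arc s t ≡ true) (sym (strictlyInverseˡ _)) (sym (strictlyInverseˡ _))
        (arcs v w a (ok (E-col (Orientation.arcEdge O v w a)) v))
      where
      sol = colour (*↔× {Graph.n G} {Graph.n H}) (cover O)
      x = proj₁ sol
      ok = proj₂ sol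
      arcs : ∀ v w → Orientation.Arc O v w →
             along arc (out O (col v) (col w) v) (x (col v) v) (x (col w) (mate (col v) (col w) v)) ≡ true →
             arc (x (col v) v) (x (col w) w) ≡ true
      arcs v w a h rewrite out-true O {col v} {col w} {v} {w} refl refl a
                         | mate-real {col v} {col w} {v} {w} refl (Orientation.arcEdge O v w a) refl = h

-- The bound

geometric : ℕ → ℕ → ℕ
geometric q zero    = 0
geometric q (suc k) = 1 + q * geometric q k

geometric-sum : ∀ p k → 1 + geometric (suc p) k * p ≡ suc p ^ k
geometric-sum p zero    = refl
geometric-sum p (suc k) = begin
  1 + (1 + suc p * g) * p  ≡⟨ cong suc (*-distribʳ-+ p 1 (suc p * g)) ⟩
  1 + (1 * p + suc p * g * p) ≡⟨ cong (λ t → 1 + (t + suc p * g * p)) (+-identityʳ p) ⟩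
  suc p + suc p * g * p    ≡⟨ cong (suc p +_) (*-assoc (suc p) g p) ⟩
  suc p + suc p * (g * p)  ≡⟨ *-suc (suc p) (g * p) ⟨
  suc p * (1 + g * p)      ≡⟨ cong (suc p *_) (geometric-sum p k) ⟩
  suc p * suc p ^ k        ∎
  where
  open ≡-Reasoning
  g = geometric (suc p) k

n<2^n : ∀ n → n < 2 ^ n
n<2^n zero    = s≤s z≤n
n<2^n (suc n) = begin-strict
  suc n              <⟨ s≤s (n<2^n n) ⟩
  1 + 2 ^ n          ≤⟨ +-monoˡ-≤ (2 ^ n) (≤-trans (s≤s z≤n) (n<2^n n)) ⟩
  2 ^ n + 2 ^ n      ≡⟨ cong (2 ^ n +_) (+-identityʳ (2 ^ n)) ⟨
  2 ^ suc n          ∎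
  where open ≤-Reasoning

-- From `1 ≤ r` follows `2 ≤ 2 ^ r`, so the divisor is positive and the division exact.
bound : ∀ k r → 1 ≤ r → (2 ^ (k * r) ∸ 1) div (2 ^ r ∸ 1) ≡ geometric (2 ^ r) k
bound k (suc r) _ = trans (cong (λ t → (t ∸ 1) div (2 ^ suc r ∸ 1)) (trans (cong (2 ^_) (*-comm k (suc r))) (sym (^-*-assoc 2 (suc r) k))))
                          (quotient (2 ^ suc r) (≤-trans (s≤s (s≤s z≤n)) (n<2^n (suc r))))
  where
  quotient : ∀ q → 2 ≤ q → (q ^ k ∸ 1) div (q ∸ 1) ≡ geometric q k
  quotient (suc zero) (s≤s ())
  quotient (suc (suc p)) _ = trans (cong (λ t → (t ∸ 1) div suc p) (sym (geometric-sum (suc p) k)))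
                                   (m*n/n≡m (geometric (suc (suc p)) k) (suc p))

-- Induction on the number of rows

AtMost : ℕ → ℕ → Set₁
AtMost k r = Σ ℕ λ m → m ≤ geometric (2 ^ r) k × Universal (Fin k × Fin (suc r)) (K× k (suc r)) m

Below : ℕ → ℕ → Set₁
Below k r = Σ ℕ λ m → m < geometric (2 ^ r) k × Universal (Fin k × Fin (suc r)) (K× k (suc r)) m

-- The slack of one in `m < geometric q k` becomes `q` after multiplication, which pays for the
-- `suc r ≤ q` new vertices.
below-suc : ∀ {k r} → Below k r → Below (suc k) r
below-suc {k} {r} (m , m<g , U) = _ , s≤s (begin
  suc r + q * m      ≤⟨ +-monoˡ-≤ (q * m) (n<2^n r) ⟩
  q + q * m          ≡⟨ *-suc q m ⟨
  q * suc m          ≤⟨ *-monoʳ-≤ q m<g ⟩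
  q * geometric q k  ∎) , addRow U
  where
  open ≤-Reasoning
  q = 2 ^ r

below-+ : ∀ {k r} i → Below k r → Below (i + k) r
below-+ zero    B = B
below-+ (suc i) B = below-suc (below-+ i B)

-- For two rows the bound is `1 + q`, so a target of order at most `q` is strictly below it.
below-two : ∀ {r m} → m ≤ 2 ^ r → Universal (Fin (suc r)) (K (suc r)) m → Below 2 r
below-two {r} {m} m≤q U = m , s≤s (≤-trans m≤q (≤-reflexive (sym q≡))) , double U
  where
  q≡ : 2 ^ r * (1 + 2 ^ r * 0) ≡ 2 ^ r
  q≡ = trans (cong (λ t → 2 ^ r * suc t) (*-comm (2 ^ r) 0)) (*-identityʳ (2 ^ r))

-- It starts from 56 < 64. If `m + 1 ≤ q`, then `2 m + 2 ≤ 2 q`, so `2 m + 1` stays below the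
-- doubled power.
cliques : ∀ i → Σ ℕ λ m → m < 2 ^ (6 + i) × Universal (Fin (7 + i)) (K (7 + i)) m
cliques zero = 56 , from-yes (57 ≤? 64) , clique₇
cliques (suc i) with cliques i
... | m , m<q , U = 1 + 2 * m , ≤-trans (≤-reflexive (sym (*-suc 2 m))) (*-monoʳ-≤ 2 m<q) , addClass U

atMost : ∀ k r → 1 ≤ r → AtMost k r
atMost zero r _ = 0 , z≤n , record
  { X = ⊥ ; size = 0↔⊥ ; arc = λ () ; asym = λ () ; colour = λ _ S → (λ { (() , _) }) , λ { {() , _} } }
-- Classes in a single row are never adjacent, so one vertex serves.
atMost (suc zero) r _ = 1 , s≤s z≤n , record
  { X = ⊤ ; size = 1↔⊤ ; arc = λ _ _ → false ; asym = λ _ _ ()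
  ; colour = λ _ S → (λ _ _ → tt) , λ { {zero , _} {zero , _} (h , _) → ⊥-elim (h refl) } }
atMost (suc (suc k)) r 1≤r = cases k r 1≤r
  where
  weaken : ∀ {k r} → Below k r → AtMost k r
  weaken (m , m<g , U) = m , <⇒≤ m<g , U
  from : ∀ {r} k k₀ → Below k₀ r → AtMost (k + k₀) r
  from k k₀ B = weaken (below-+ k B)
  two : ∀ k {r} → Below 2 r → AtMost (2 + k) r
  two k {r} B = subst (λ t → AtMost t r) (+-comm k 2) (from k 2 B)
  three : ∀ k {r} → Below 3 r → AtMost (3 + k) r
  three k {r} B = subst (λ t → AtMost t r) (+-comm k 3) (from k 3 B)
  cases : ∀ k r → 1 ≤ r → AtMost (2 + k) r
  cases k 1 _ = two k (below-two ≤-refl clique₂)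
  cases k 2 _ = two k (below-two ≤-refl clique₃)
  cases k 3 _ = two k (below-two ≤-refl clique₄)
  -- Here 17 = 2 * 8 + 1 meets the bound 1 + 16 exactly, without the slack that further rows
  -- require.
  cases zero 4 _ = 17 , ≤-refl , double (addClass clique₄)
  -- From three rows on there is slack: 3 * 5 * 16 = 240 against 1 + 16 + 256 = 273, and for six
  -- columns 3 * 6 * 32 = 576 against 1057.
  cases (suc k) 4 _ = three k (240 , from-yes (241 ≤? geometric 16 3) , threeRows 4)
  cases zero 5 _ = 33 , ≤-refl , double clique₆
  cases (suc k) 5 _ = three k (576 , from-yes (577 ≤? geometric 32 3) , threeRows 5)
  cases k (suc (suc (suc (suc (suc (suc i)))))) _ with cliques i
  ... | m , m<q , U = two k (below-two (<⇒≤ m<q) U)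

theorem14 : (G H : Graph) (k ℓ : ℕ) → ChiSquare G k → ChiSquare H ℓ → 2 ≤ ℓ →
    UpperOrientedChiAtMost (ProdV G H) (ProdAdj G H)
    ((2 ^ (k * (ℓ ∸ 1)) ∸ 1) div (2 ^ (ℓ ∸ 1) ∸ 1))
theorem14 G H k (suc r) ((f , f-ok) , _) ((g , g-ok) , _) (s≤s 1≤r) with atMost k r 1≤r
... | m , m≤g , U = m , ≤-trans m≤g (≤-reflexive (sym (bound k r 1≤r))) , homs G H f f-ok g g-ok U
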